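{- Let $n\ge 4$ and let $A$ be a nonempty subset of $[n]$ such that $QJ(n,A)$ has at least $4$ vertices. Then $QJ(n,A)$ is paired 2-coverable.
   Context: Let $[n]=\{1,\dots,n\}$. The Johnson graph $J(n,k)$ has as vertices the $k$-element subsets of $[n]$, two being adjacent if they share exactly $k-1$ elements. For a nonempty $A=\{a_1<a_2<\dots<a_m\}\subseteq[n]$, the graph $QJ(n,A)$ is obtained by taking, for each $i$, a copy of $J(n,a_i)$ (level $i$), and, for each $i<m$, adding an edge between a vertex $u$ of $J(n,a_i)$ and a vertex $v$ of $J(n,a_{i+1})$ whenever $u\subseteq v$. There are no other edges. A graph $G$ is called paired 2-coverable if for any four distinct vertices $u,v,x,y$ of $G$ there exist two vertex-disjoint paths in $G$, one with endpoints $u$ and $v$ and the other with endpoints $x$ and $y$, which together cover every vertex of $G$. -}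

module Defs where

open import Data.Nat using (ℕ; suc; _<_; _≤_)
open import Data.Bool using (Bool; true; false)
open import Data.Fin.Subset using (Subset; ∣_∣; _∩_; _⊆_)
open import Data.List using (List; []; _∷_)
open import Data.List.Membership.Propositional using (_∈_; _∉_)
open import Data.List.Relation.Unary.Unique.Propositional using (Unique)
open import Data.Product using (Σ; _×_; ∃)
open import Data.Sum using (_⊎_)
open import Relation.Binary.PropositionalEquality using (_≡_; _≢_)

-- A set A ⊆ ℕ of level sizes, given by its characteristic function.
-- Vertices of QJ(n,A) are the subsets S of [n] (Fin n) with |S| ∈ A;
-- the level of S is |S|, so distinct levels give disjoint vertex sets.
IsVertex : ∀ {n} → (ℕ → Bool) → Subset n → Set
IsVertex A S = A ∣ S ∣ ≡ true

ConsecIncl : ∀ {n} → (ℕ → Bool) → Subset n → Subset n → Set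
ConsecIncl A S T =
  ∣ S ∣ < ∣ T ∣ × (∀ k → ∣ S ∣ < k → k < ∣ T ∣ → A k ≡ false) × S ⊆ T

JohnsonAdj : ∀ {n} → Subset n → Subset n → Set
JohnsonAdj S T = ∣ S ∣ ≡ ∣ T ∣ × suc ∣ S ∩ T ∣ ≡ ∣ S ∣

Adj : ∀ {n} → (ℕ → Bool) → Subset n → Subset n → Set
Adj A S T = IsVertex A S × IsVertex A T ×
  (JohnsonAdj S T ⊎ ConsecIncl A S T ⊎ ConsecIncl A T S)

data Walk {n} (A : ℕ → Bool) : Subset n → Subset n → List (Subset n) → Set where
  single : ∀ {u} → IsVertex A u → Walk A u u (u ∷ [])
  step   : ∀ {u w v p} → Adj A u w → Walk A w v p → Walk A u v (u ∷ p)

Path : ∀ {n} → (ℕ → Bool) → Subset n → Subset n → List (Subset n) → Set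
Path A u v p = Walk A u v p × Unique p

PairedTwoCoverable : ∀ {n} → (ℕ → Bool) → Set
PairedTwoCoverable {n} A =
  ∀ (u v x y : Subset n) →
  IsVertex A u → IsVertex A v → IsVertex A x → IsVertex A y →
  u ≢ v → u ≢ x → u ≢ y → v ≢ x → v ≢ y → x ≢ y →
  Σ (List (Subset n)) λ p → Σ (List (Subset n)) λ q →
    Path A u v p × Path A x y q ×
    (∀ S → S ∈ p → S ∉ q) ×
    (∀ S → IsVertex A S → S ∈ p ⊎ S ∈ q)

AtLeastFourVertices : ∀ {n} → (ℕ → Bool) → Set
AtLeastFourVertices {n} A =
  Σ (Subset n) λ a → Σ (Subset n) λ b → Σ (Subset n) λ c → Σ (Subset n) λ d →
  IsVertex A a × IsVertex A b × IsVertex A c × IsVertex A d ×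
  a ≢ b × a ≢ c × a ≢ d × b ≢ c × b ≢ d × c ≢ d

{-# OPTIONS --safe #-}
module Submission where

-- QJ(n+1,A) splits into the sets without and with the first point; the two halves are QJ(n,A)
-- and QJ(n,A−1). By induction on n, for all A ⊆ {0,…,n} at once, both are Hamilton connected and
-- paired 2-coverable, and their covers are joined along edges between the halves. If one half
-- contains all four terminals, the first edge of a path is replaced by a detour through the
-- other half. If it contains three of them, one edge between the halves is needed, and none if
-- it contains just the two ends of one path. If both paths have an end in each half, two disjoint
-- edges avoiding the terminals are needed; they are found among sets that agree outside four
-- points, unless one half consists of the empty and the full set only, in which case these are
-- joined to a whole level of the other half. The induction starts with an exhaustive search for
-- n = 3, and for n = 4 when A has at most one of the levels 1, 2, 3, where the halves have too
-- few vertices for these arguments.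

open import Defs
open import Algebra.Solver.CommutativeMonoid as CommutativeMonoidSolver using ()
open import Data.Bool using (Bool; true; false; not; if_then_else_; T; _∧_; _∨_)
open import Data.Bool.ListAction using (any; all)
open import Data.Bool.Properties using (not-involutive; T-∧; T-∨; T-≡) renaming (_≟_ to _≟ᵇ_)
open import Data.Empty using (⊥-elim)
open import Data.Fin.Subset using (Subset; ∣_∣; _∩_; _⊆_; ⊥; ⊤; ∁)
open import Data.Fin.Subset.Properties using (∩-comm; ∩-idem; in⊆in; out⊆; s⊆s; drop-∷-⊆; ⊆-refl; ⊆-antisym; ⊆-min; ⊆-max; _⊆?_; p∩q⊆q; x∈p∩q⁺; p⊆q⇒∁p⊇∁q; p⊆q⇒∣p∣≤∣q∣; ∣p∣≤n; ∣p∣≡n⇒p≡⊤; ∣⊥∣≡0; ∣⊤∣≡n; ∣∁p∣≡n∸∣p∣)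
open import Data.List using (List; []; _∷_; _++_; map; length)
open import Data.List.Membership.DecPropositional as DecMembership using ()
open import Data.List.Membership.Propositional using (_∈_; _∉_; find)
open import Data.List.Membership.Propositional.Properties using (∈-map⁺; ∈-map⁻; ∈-++⁺ˡ; ∈-++⁺ʳ; ∈-++⁻; ∈-∃++)
open import Data.List.Membership.Propositional.Properties.WithK using (unique∧set⇒bag)
open import Data.List.Properties using (map-++; length-++; length-map)
open import Data.List.Relation.Binary.BagAndSetEquality using (∼bag⇒↭)
open import Data.List.Relation.Binary.Permutation.Propositional using (_↭_; ↭-refl; ↭-sym; ↭-trans; ↭-reflexive; prep; swap; ↭⇒↭ₛ)
open import Data.List.Relation.Binary.Permutation.Propositional.Properties using (++⁺; ++⁺ˡ; ++⁺ʳ; ++-comm; ++-commutativeMonoid; shift; ∈-resp-↭; ↭-length) renaming (map⁺ to ↭-map⁺)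
import Data.List.Relation.Binary.Permutation.Setoid.Properties as ↭ₛ
open import Data.List.Relation.Unary.All as All using (All; []; _∷_; all?)
open import Data.List.Relation.Unary.All.Properties using (¬Any⇒All¬; all⁺; ++⁻ˡ; ++⁻ʳ)
open import Data.List.Relation.Unary.Any using (Any; here; there; any?)
open import Data.List.Relation.Unary.Any.Properties using (any⁻)
open import Data.List.Relation.Unary.Unique.Propositional using (Unique; []; _∷_)
import Data.List.Relation.Unary.Unique.Propositional.Properties as Unique
open import Data.Nat
open import Data.Nat.Properties
open import Data.Product using (_×_; _,_; ∃; proj₁; proj₂)
open import Data.Sum using (_⊎_; inj₁; inj₂) renaming (map to map-⊎)
open import Data.Unit using (tt)
open import Data.Vec using (Vec; []; _∷_; take; here) renaming (_++_ to _++ᵛ_)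
open import Data.Vec.Properties using (∷-injectiveʳ; ≡-dec; map-id; map-cong; map-∘; take++drop≡id; ++-injectiveˡ)
open import Function using (_∘_; mk⇔; case_of_; Equivalence)
open import Relation.Binary.PropositionalEquality using (_≡_; _≢_; refl; sym; trans; cong; cong₂; subst; ≢-sym; setoid)
open import Relation.Nullary using (Dec; yes; no; ¬?; ⌊_⌋; _×-dec_; _⊎-dec_; _→-dec_)
open import Relation.Nullary.Decidable using (toWitness; map′; decidable-stable)

-- Walks, covers and the two halves

Levels : Set
Levels = ℕ → Bool

Adj-sym : ∀ {n} {A : Levels} {S T : Subset n} → Adj A S T → Adj A T S
Adj-sym {S = S} {T} (vS , vT , inj₁ (e , c)) =
  vT , vS , inj₁ (sym e , trans (cong (suc ∘ ∣_∣) (∩-comm T S)) (trans c e))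
Adj-sym (vS , vT , inj₂ (inj₁ i)) = vT , vS , inj₂ (inj₂ i)
Adj-sym (vS , vT , inj₂ (inj₂ i)) = vT , vS , inj₂ (inj₁ i)

module _ {n : ℕ} {A : Levels} where

  Walk-join : ∀ {u w x v : Subset n} {p q} →
    Walk A u w p → Adj A w x → Walk A x v q → Walk A u v (p ++ q)
  Walk-join (single _) e W  = step e W
  Walk-join (step d V) e W = step d (Walk-join V e W)

  Walk-reverse : ∀ {u v : Subset n} {p} → Walk A u v p → ∃ λ q → Walk A v u q × q ↭ p
  Walk-reverse (single vu) = _ , single vu , ↭-refl
  Walk-reverse {u} (step e W) with Walk-reverse W
  ... | q , W′ , q↭p = q ++ u ∷ [] , Walk-join W′ (Adj-sym e) (single (proj₁ e)) ,
    ↭-trans (++-comm q (u ∷ [])) (prep u q↭p)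

-- The first point counts towards the size, so sets containing it are governed by the level set
-- shifted down by one.
half : Bool → Levels → Levels
half false A = A
half true  A = A ∘ suc

IsVertex-∷ : ∀ {n} {A : Levels} b (S : Subset n) → IsVertex (half b A) S → IsVertex A (b ∷ S)
IsVertex-∷ false S v = v
IsVertex-∷ true  S v = v

IsVertex-tail : ∀ {n} {A : Levels} b (S : Subset n) → IsVertex A (b ∷ S) → IsVertex (half b A) S
IsVertex-tail false S v = v
IsVertex-tail true  S v = v

JohnsonAdj-∷ : ∀ {n} b (S T : Subset n) → JohnsonAdj S T → JohnsonAdj (b ∷ S) (b ∷ T)
JohnsonAdj-∷ false S T j       = j
JohnsonAdj-∷ true  S T (e , c) = cong suc e , cong suc c

ConsecIncl-∷ : ∀ {n} {A : Levels} b (S T : Subset n) →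
  ConsecIncl (half b A) S T → ConsecIncl A (b ∷ S) (b ∷ T)
ConsecIncl-∷ false S T (lt , gap , S⊆T) = lt , gap , s⊆s S⊆T
ConsecIncl-∷ true  S T (lt , gap , S⊆T) =
  s<s lt , (λ { (suc k) l r → gap k (s<s⁻¹ l) (s<s⁻¹ r) }) , in⊆in S⊆T

Adj-∷ : ∀ {n} {A : Levels} b (S T : Subset n) → Adj (half b A) S T → Adj A (b ∷ S) (b ∷ T)
Adj-∷ b S T (vS , vT , r) = IsVertex-∷ b S vS , IsVertex-∷ b T vT ,
  map-⊎ (JohnsonAdj-∷ b S T) (map-⊎ (ConsecIncl-∷ b S T) (ConsecIncl-∷ b T S)) r

Walk-∷ : ∀ {n} {A : Levels} b {u v : Subset n} {p} →
  Walk (half b A) u v p → Walk A (b ∷ u) (b ∷ v) (map (b ∷_) p)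
Walk-∷ b (single {u} vu)     = single (IsVertex-∷ b u vu)
Walk-∷ b (step {u} {w} e W)  = step (Adj-∷ b u w e) (Walk-∷ b W)

vertices : ∀ n → Levels → List (Subset n)
vertices zero    A = if A 0 then [] ∷ [] else []
vertices (suc n) A = map (false ∷_) (vertices n A) ++ map (true ∷_) (vertices n (A ∘ suc))

∈-vertices : ∀ {n} {A : Levels} (S : Subset n) → IsVertex A S → S ∈ vertices n A
∈-vertices {A = A} [] vS with A 0
... | true = here refl
∈-vertices (false ∷ S) vS = ∈-++⁺ˡ (∈-map⁺ _ (∈-vertices S vS))
∈-vertices (true ∷ S)  vS = ∈-++⁺ʳ _ (∈-map⁺ _ (∈-vertices S vS))

-- `vertices n A` lists each vertex exactly once, so one permutation says both that the walk repeats
-- nothing and that it misses nothing. Permutations also behave well under concatenation, which is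
-- how covers get joined.
HamPath : ∀ {n} → Levels → Subset n → Subset n → Set
HamPath {n} A u v = ∃ λ p → Walk A u v p × p ↭ vertices n A

PairedCover : ∀ {n} → Levels → (u v x y : Subset n) → Set
PairedCover {n} A u v x y =
  ∃ λ p → ∃ λ q → Walk A u v p × Walk A x y q × p ++ q ↭ vertices n A

record Terminals {n} (A : Levels) (u v x y : Subset n) : Set where
  constructor terminals
  field
    vu : IsVertex A u
    vv : IsVertex A v
    vx : IsVertex A x
    vy : IsVertex A y
    u≢v : u ≢ v
    u≢x : u ≢ x
    u≢y : u ≢ y
    v≢x : v ≢ x
    v≢y : v ≢ y
    x≢y : x ≢ y

Terminals-swap : ∀ {n} {A : Levels} {u v x y : Subset n} → Terminals A u v x y → Terminals A x y u v
Terminals-swap (terminals vu vv vx vy uv ux uy vx′ vy′ xy) =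
  terminals vx vy vu vv xy (ux ∘ sym) (vx′ ∘ sym) (uy ∘ sym) (vy′ ∘ sym) uv

Terminals-flip : ∀ {n} {A : Levels} {u v x y : Subset n} → Terminals A u v x y → Terminals A u v y x
Terminals-flip (terminals vu vv vx vy uv ux uy vx′ vy′ xy) =
  terminals vu vv vy vx uv uy ux vy′ vx′ (xy ∘ sym)

module _ {n : ℕ} {A : Levels} {u v x y : Subset n} where

  PairedCover-swap : PairedCover A u v x y → PairedCover A x y u v
  PairedCover-swap (p , q , P , Q , c) = q , p , Q , P , ↭-trans (++-comm q p) c

  PairedCover-flip : PairedCover A u v x y → PairedCover A u v y x
  PairedCover-flip (p , q , P , Q , c) with Walk-reverse Q
  ... | q′ , Q′ , e = p , q′ , P , Q′ , ↭-trans (++⁺ˡ p e) c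

HamPath-reverse : ∀ {n} {A : Levels} {u v : Subset n} → HamPath A u v → HamPath A v u
HamPath-reverse (p , W , c) with Walk-reverse W
... | q , W′ , e = q , W′ , ↭-trans e c

HamConnected : ℕ → Levels → Set
HamConnected n A = ∀ {u v : Subset n} → IsVertex A u → IsVertex A v → u ≢ v → HamPath A u v

PairedCoverable : ℕ → Levels → Set
PairedCoverable n A = ∀ {u v x y : Subset n} → Terminals A u v x y → PairedCover A u v x y

vertices-split : ∀ {n} {A : Levels} b {X Y : List (Subset n)} →
  X ↭ vertices n (half b A) → Y ↭ vertices n (half (not b) A) →
  map (b ∷_) X ++ map (not b ∷_) Y ↭ vertices (suc n) A
vertices-split false cX cY = ++⁺ (↭-map⁺ _ cX) (↭-map⁺ _ cY)
vertices-split true {X} {Y} cX cY =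
  ↭-trans (++-comm (map (true ∷_) X) (map (false ∷_) Y)) (++⁺ (↭-map⁺ _ cY) (↭-map⁺ _ cX))

-- Edges between the halves

_≟ˢ_ : ∀ {n} (S T : Subset n) → Dec (S ≡ T)
_≟ˢ_ = ≡-dec _≟ᵇ_

∣S∣≡0⇒S≡⊥ : ∀ {n} (S : Subset n) → ∣ S ∣ ≡ 0 → S ≡ ⊥
∣S∣≡0⇒S≡⊥ []          _ = refl
∣S∣≡0⇒S≡⊥ (false ∷ S) e = cong (false ∷_) (∣S∣≡0⇒S≡⊥ S e)

∁-involutive : ∀ {n} (S : Subset n) → ∁ (∁ S) ≡ S
∁-involutive S = trans (sym (map-∘ not not S)) (trans (map-cong not-involutive S) (map-id S))

∁-injective : ∀ {n} {S T : Subset n} → ∁ S ≡ ∁ T → S ≡ T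
∁-injective {S = S} {T} e = trans (sym (∁-involutive S)) (trans (cong ∁ e) (∁-involutive T))

shrink : ∀ {n m} (S : Subset n) → ∣ S ∣ ≡ suc m → ∃ λ T → T ⊆ S × ∣ T ∣ ≡ m
shrink (true ∷ S)  e = false ∷ S , out⊆ ⊆-refl , suc-injective e
shrink (false ∷ S) e with shrink S e
... | T , T⊆S , c = false ∷ T , s⊆s T⊆S , c

-- At the first point of `S`, drop it if `R` has it and keep it otherwise, so that the result
-- already differs from `R` there; when it is kept, a second point of `S` remains to be dropped.
shrink-≢ : ∀ {n m} (S : Subset n) → ∣ S ∣ ≡ suc (suc m) → ∀ R →
  ∃ λ T → T ⊆ S × ∣ T ∣ ≡ suc m × T ≢ R
shrink-≢ (true ∷ S) e (true ∷ R) = false ∷ S , out⊆ ⊆-refl , suc-injective e , λ ()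
shrink-≢ (true ∷ S) e (false ∷ R) with shrink S (suc-injective e)
... | T , T⊆S , c = true ∷ T , in⊆in T⊆S , cong suc c , λ ()
shrink-≢ (false ∷ S) e (_ ∷ R) with shrink-≢ S e R
... | T , T⊆S , c , T≢R = false ∷ T , s⊆s T⊆S , c , T≢R ∘ ∷-injectiveʳ

enlarge : ∀ {n j} (S : Subset n) → ∣ S ∣ ≤ j → j ≤ n → ∃ λ T → S ⊆ T × ∣ T ∣ ≡ j
enlarge [] z≤n z≤n = [] , ⊆-refl , refl
enlarge (true ∷ S) (s≤s l) (s≤s r) with enlarge S l r
... | T , S⊆T , c = true ∷ T , in⊆in S⊆T , cong suc c
enlarge {suc n} {j} (false ∷ S) l r with ∣ S ∣ <? j
enlarge {suc n} {suc j} (false ∷ S) _ (s≤s r) | yes (s≤s l) with enlarge S l r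
... | T , S⊆T , c = true ∷ T , out⊆ S⊆T , cong suc c
enlarge {suc n} {j} (false ∷ S) l r | no ≮ = false ∷ S , ⊆-refl , ≤-antisym l (≮⇒≥ ≮)

search : ∀ (A : Levels) m → (∃ λ k → k < m × A k ≡ true) ⊎ (∀ k → k < m → A k ≡ false)
search A zero = inj₂ λ _ ()
search A (suc m) with A 0 in eq | search (A ∘ suc) m
... | true  | _                      = inj₁ (0 , z<s , eq)
... | false | inj₁ (k , k<m , vk)    = inj₁ (suc k , s<s k<m , vk)
... | false | inj₂ none              = inj₂ λ { zero _ → eq ; (suc k) k<m → none k (s<s⁻¹ k<m) }

-- Inclusion edges from level `k` upwards end in the first occupied level above it, found by
-- induction on the distance from `suc k` to `l`.
next-level : ∀ {A : Levels} {k l} → k < l → A l ≡ true →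
  ∃ λ m → k < m × m ≤ l × A m ≡ true × (∀ j → k < j → j < m → A j ≡ false)
next-level {A} {k} {l} k<l vl = go (l ∸ suc k) (m∸n+n≡m k<l)
  where
  go : ∀ {k} d → d + suc k ≡ l →
    ∃ λ m → k < m × m ≤ l × A m ≡ true × (∀ j → k < j → j < m → A j ≡ false)
  go zero refl = l , ≤-refl , ≤-refl , vl , λ j k<j j<l → ⊥-elim (<⇒≱ j<l k<j)
  go {k} (suc d) e with A (suc k) in eq
  ... | true = suc k , ≤-refl , ≤-trans (m≤n+m (suc k) (suc d)) (≤-reflexive e) , eq ,
               λ j k<j j<m → ⊥-elim (<⇒≱ j<m k<j)
  ... | false with go {suc k} d (trans (+-suc d (suc k)) e)
  ...   | m , k<m , m≤l , vm , gap = m , <-trans (n<1+n k) k<m , m≤l , vm , gap′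
    where
    gap′ : ∀ j → k < j → j < m → A j ≡ false
    gap′ j k<j j<m with suc k ≟ j
    ... | yes refl = eq
    ... | no ≢     = gap j (≤∧≢⇒< k<j ≢) j<m

-- The adjacencies between S without the first point and T with it.
data Cross {n} (A : Levels) (S T : Subset n) : Set where
  same : T ⊆ S → ∣ S ∣ ≡ suc ∣ T ∣ → A ∣ S ∣ ≡ true → Cross A S T
  up   : S ⊆ T → A ∣ S ∣ ≡ true → A (suc ∣ T ∣) ≡ true →
         (∀ k → ∣ S ∣ < k → k < suc ∣ T ∣ → A k ≡ false) → Cross A S T

Cross⇒Adj : ∀ {n} {A : Levels} {S T : Subset n} → Cross A S T → Adj A (false ∷ S) (true ∷ T)
Cross⇒Adj {A = A} {S} {T} (same T⊆S e v) =
  v , subst (λ k → A k ≡ true) e v , inj₁ (e , trans (cong (suc ∘ ∣_∣) S∩T≡T) (sym e))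
  where
  S∩T≡T : S ∩ T ≡ T
  S∩T≡T = ⊆-antisym (p∩q⊆q S T) (λ i → x∈p∩q⁺ (T⊆S i , i))
Cross⇒Adj (up S⊆T v w gap) = v , w , inj₂ (inj₁ (s≤s (p⊆q⇒∣p∣≤∣q∣ S⊆T) , gap , out⊆ S⊆T))

-- Complementation

co : ℕ → Levels → Levels
co n A k = A (n ∸ k)

-- Complementing in the larger ground set exchanges the halves and reverses inclusions, so `same`
-- goes to `same` and `up` to `up`. This carries results on the half without the first point over to
-- the other half.
Cross-co : ∀ {n} {A : Levels} {S T : Subset n} → Cross (co (suc n) A) S T → Cross A (∁ T) (∁ S)
Cross-co {n} {A} {S} {T} (same T⊆S e v) = same (p⊆q⇒∁p⊇∁q T⊆S) e′ (trans (cong A ∣∁T∣) v)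
  where
  ∣∁T∣ : ∣ ∁ T ∣ ≡ suc n ∸ ∣ S ∣
  ∣∁T∣ = trans (∣∁p∣≡n∸∣p∣ T) (sym (cong (suc n ∸_) e))
  e′ : ∣ ∁ T ∣ ≡ suc ∣ ∁ S ∣
  e′ = trans ∣∁T∣ (trans (+-∸-assoc 1 (∣p∣≤n S)) (cong suc (sym (∣∁p∣≡n∸∣p∣ S))))
Cross-co {n} {A} {S} {T} (up S⊆T v w gap) =
  up (p⊆q⇒∁p⊇∁q S⊆T) (trans (cong A (∣∁p∣≡n∸∣p∣ T)) w) (trans (cong A 1+∣∁S∣) v) gap′
  where
  1+∣∁S∣ : suc ∣ ∁ S ∣ ≡ suc n ∸ ∣ S ∣
  1+∣∁S∣ = trans (cong suc (∣∁p∣≡n∸∣p∣ S)) (sym (+-∸-assoc 1 (∣p∣≤n S)))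
  gap′ : ∀ k → ∣ ∁ T ∣ < k → k < suc ∣ ∁ S ∣ → A k ≡ false
  -- Level `k` of `A` is level `suc n ∸ k` of `co (suc n) A`; the reflection swaps the two strict
  -- bounds.
  gap′ k l r = trans (cong A (sym (m∸[m∸n]≡n k≤))) (gap (suc n ∸ k) l′ r′)
    where
    k≤ : k ≤ suc n
    k≤ = ≤-trans (<⇒≤ r) (s≤s (∣p∣≤n (∁ S)))
    l′ : ∣ S ∣ < suc n ∸ k
    l′ = subst (_< suc n ∸ k) (m∸[m∸n]≡n (m≤n⇒m≤1+n (∣p∣≤n S)))
           (∸-monoʳ-< (subst (k <_) 1+∣∁S∣ r) (m∸n≤m (suc n) ∣ S ∣))
    r′ : suc n ∸ k < suc ∣ T ∣
    r′ = subst (suc n ∸ k <_) (m∸[m∸n]≡n (s≤s (∣p∣≤n T)))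
           (∸-monoʳ-< (subst (_< k) (∣∁p∣≡n∸∣p∣ T) l) k≤)

Link : ∀ {n} → Levels → Bool → Subset n → Subset n → Set
Link A false S T = Cross A S T
Link A true  S T = Cross A T S

Link⇒Adj : ∀ {n} {A : Levels} b {S T : Subset n} → Link A b S T → Adj A (b ∷ S) (not b ∷ T)
Link⇒Adj false c = Cross⇒Adj c
Link⇒Adj true  c = Adj-sym (Cross⇒Adj c)

Link-target : ∀ {n} {A : Levels} b (S T : Subset n) → Link A b S T → IsVertex (half (not b) A) T
Link-target b S T c = IsVertex-tail (not b) T (proj₁ (proj₂ (Link⇒Adj b c)))

-- The excluded sets are the empty and the full subset of the larger ground set. They can have a
-- single neighbour across although the other half has more vertices, as the empty set does when the
-- levels are 0, 1 and 2.
Inner : ∀ {n} → Bool → Subset n → Set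
Inner     false S = ∣ S ∣ ≢ 0
Inner {n} true  S = ∣ S ∣ ≢ n

-- In both cases the vertices for B have a Hamilton path from T to R; in the second it has length 0.
Avoids : ∀ {n} → Levels → Subset n → Subset n → Set
Avoids {n} B R T = T ≢ R ⊎ (T ≡ R × ∀ (Z : Subset n) → IsVertex B Z → Z ≡ R)

IsVertex-co : ∀ {n} (A : Levels) b (S : Subset n) →
  IsVertex (half b A) S → IsVertex (half (not b) (co (suc n) A)) (∁ S)
IsVertex-co {n} A false S v = trans (cong (λ k → A (n ∸ k)) (∣∁p∣≡n∸∣p∣ S))
  (trans (cong A (m∸[m∸n]≡n (∣p∣≤n S))) v)
IsVertex-co {n} A true S v = trans (cong (λ k → A (suc n ∸ k)) (∣∁p∣≡n∸∣p∣ S))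
  (trans (cong A (trans (+-∸-assoc 1 (m∸n≤m n ∣ S ∣)) (cong suc (m∸[m∸n]≡n (∣p∣≤n S))))) v)

Avoids-co : ∀ {n} (A : Levels) (R T : Subset n) →
  Avoids (half true (co (suc n) A)) (∁ R) T → Avoids (half false A) R (∁ T)
Avoids-co A R T (inj₁ ≢) = inj₁ λ { refl → ≢ (sym (∁-involutive T)) }
Avoids-co A R T (inj₂ (refl , only)) = inj₂ (∁-involutive R ,
  λ Z vZ → ∁-injective (only (∁ Z) (IsVertex-co A false Z vZ)))

-- A nonempty set exchanges one of its points for the first point; the empty set goes up to a
-- superset in the next occupied level.
touch₀ : ∀ {n} {A : Levels} (S : Subset n) {l} → IsVertex A S →
  A l ≡ true → 0 < l → l ≤ suc n → ∃ λ T → Cross A S T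
touch₀ {A = A} S vS vl 0<l l≤ with ∣ S ∣ in e
touch₀ {A = A} S vS vl 0<l l≤ | suc m with shrink S e
... | T , T⊆S , c = T , same T⊆S (trans e (cong suc (sym c))) (trans (cong A e) vS)
touch₀ {A = A} S vS vl 0<l l≤ | zero with next-level 0<l vl
... | suc m , _ , m≤l , vm , gap with enlarge S (≤-trans (≤-reflexive e) z≤n) (s≤s⁻¹ (≤-trans m≤l l≤))
...   | T , S⊆T , c = T , up S⊆T (trans (cong A e) vS) (trans (cong (A ∘ suc) c) vm)
  λ k l r → gap k (subst (_< k) e l) (subst (λ j → k < suc j) c r)

-- With two or more points in `S` there are two possible exchanges, and one avoids `R`. A singleton
-- exchanges only to the empty set; if that is `R`, either no higher level is occupied and `R` is
-- alone in its half, or a superset of `S` in the next level serves.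
reach₀ : ∀ {n} {A : Levels} (S R : Subset n) → IsVertex A S → Inner false S → IsVertex (A ∘ suc) R →
  ∃ λ T → Cross A S T × Avoids (A ∘ suc) R T
reach₀ {n} {A} S R vS inner vR with ∣ S ∣ in e
... | zero        = ⊥-elim (inner refl)
... | suc (suc m) with shrink-≢ S e R
...   | T , T⊆S , c , ≢ = T , same T⊆S (trans e (cong suc (sym c))) (trans (cong A e) vS) , inj₁ ≢
reach₀ {n} {A} S R vS inner vR | suc zero with shrink S e
... | T , T⊆S , c with T ≟ˢ R | search (A ∘ suc ∘ suc) n
...   | no ≢ | _ = T , same T⊆S (trans e (cong suc (sym c))) (trans (cong A e) vS) , inj₁ ≢
...   | yes refl | inj₂ none =
  T , same T⊆S (trans e (cong suc (sym c))) (trans (cong A e) vS) , inj₂ (refl , only)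
  where
  only : ∀ Z → IsVertex (A ∘ suc) Z → Z ≡ T
  only Z vZ with ∣ Z ∣ in z
  ... | zero  = trans (∣S∣≡0⇒S≡⊥ Z z) (sym (∣S∣≡0⇒S≡⊥ T c))
  ... | suc j with () ← trans (sym vZ) (none j (subst (_≤ n) z (∣p∣≤n Z)))
...   | yes refl | inj₁ (k , k<n , vk) with next-level {A} {1} {suc (suc k)} (s<s z<s) vk
...     | suc m , s≤s 1≤m , m≤ , vm , gap
        with enlarge S (≤-trans (≤-reflexive e) 1≤m) (≤-trans (s≤s⁻¹ m≤) k<n)
...       | U , S⊆U , d = U ,
            up S⊆U (trans (cong A e) vS) (trans (cong (A ∘ suc) d) vm)
              (λ k l r → gap k (subst (_< k) e l) (subst (λ j → k < suc j) d r)) ,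
            inj₁ λ { refl → <⇒≢ 1≤m (trans (sym c) d) }

reach : ∀ {n} {A : Levels} b (S R : Subset n) → IsVertex (half b A) S → Inner b S →
  IsVertex (half (not b) A) R → ∃ λ T → Link A b S T × Avoids (half (not b) A) R T
reach false S R vS inner vR = reach₀ S R vS inner vR
reach {n} {A} true S R vS inner vR
  with reach₀ (∁ S) (∁ R) (IsVertex-co A true S vS)
         (λ e → inner (≤-antisym (∣p∣≤n S) (m∸n≡0⇒m≤n (trans (sym (∣∁p∣≡n∸∣p∣ S)) e))))
         (IsVertex-co A false R vR)
... | T , c , av = ∁ T , subst (Cross A (∁ T)) (∁-involutive S) (Cross-co c) , Avoids-co A R T av

-- At most one of `S` and `T` is empty. The level of a nonempty one lets `touch₀` link the other
-- set, and `reach₀` then links the nonempty one while avoiding the vertex already used.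
fork₀ : ∀ {n} {A : Levels} (S T : Subset n) → IsVertex A S → IsVertex A T → S ≢ T →
  ∃ λ S′ → ∃ λ T′ → Cross A S S′ × Cross A T T′ × Avoids (A ∘ suc) S′ T′
fork₀ S T vS vT S≢T with ∣ T ∣ ≟ 0
fork₀ {A = A} S T vS vT S≢T | no T≢0 with touch₀ S vS vT (n≢0⇒n>0 T≢0) (m≤n⇒m≤1+n (∣p∣≤n T))
... | S′ , c with reach₀ T S′ vT T≢0 (Link-target false S S′ c)
...   | T′ , d , av = S′ , T′ , c , d , av
fork₀ {A = A} S T vS vT S≢T | yes T≡0
  with touch₀ T vT vS (n≢0⇒n>0 S≢0) (m≤n⇒m≤1+n (∣p∣≤n S))
  where
  S≢0 : ∣ S ∣ ≢ 0
  S≢0 e = S≢T (trans (∣S∣≡0⇒S≡⊥ S e) (sym (∣S∣≡0⇒S≡⊥ T T≡0)))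
... | T′ , d with reach₀ S T′ vS S≢0 (Link-target false T T′ d)
  where
  S≢0 : ∣ S ∣ ≢ 0
  S≢0 e = S≢T (trans (∣S∣≡0⇒S≡⊥ S e) (sym (∣S∣≡0⇒S≡⊥ T T≡0)))
...   | S′ , c , inj₁ ≢ = S′ , T′ , c , d , inj₁ (≢-sym ≢)
...   | S′ , c , inj₂ (refl , only) = S′ , T′ , c , d , inj₂ (refl , only)

fork : ∀ {n} {A : Levels} b (S T : Subset n) → IsVertex (half b A) S → IsVertex (half b A) T → S ≢ T →
  ∃ λ S′ → ∃ λ T′ → Link A b S S′ × Link A b T T′ × Avoids (half (not b) A) S′ T′
fork false = fork₀
fork {n} {A} true S T vS vT S≢T
  with fork₀ (∁ S) (∁ T) (IsVertex-co A true S vS) (IsVertex-co A true T vT) (S≢T ∘ ∁-injective)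
... | S′ , T′ , c , d , av = ∁ S′ , ∁ T′ ,
  subst (Cross A (∁ S′)) (∁-involutive S) (Cross-co c) ,
  subst (Cross A (∁ T′)) (∁-involutive T) (Cross-co d) ,
  Avoids-co A (∁ S′) T′ (subst (λ X → Avoids (half true (co (suc n) A)) X T′) (sym (∁-involutive S′)) av)

-- Joining covers of the halves

vertices-sound : ∀ n {A : Levels} {S : Subset n} → S ∈ vertices n A → IsVertex A S
vertices-sound zero {A} S∈ with A 0 in eq
vertices-sound zero (here refl) | true = eq
vertices-sound (suc n) {A} S∈ with ∈-++⁻ (map (false ∷_) (vertices n A)) S∈
... | inj₁ i with ∈-map⁻ _ i
...   | T , T∈ , refl = vertices-sound n T∈
vertices-sound (suc n) {A} S∈ | inj₂ i with ∈-map⁻ _ i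
...   | T , T∈ , refl = vertices-sound n T∈

vertices-unique : ∀ n A → Unique (vertices n A)
vertices-unique zero A with A 0
... | true  = [] ∷ []
... | false = []
vertices-unique (suc n) A = Unique.++⁺
  (Unique.map⁺ ∷-injectiveʳ (vertices-unique n A))
  (Unique.map⁺ ∷-injectiveʳ (vertices-unique n (A ∘ suc)))
  disjoint
  where
  disjoint : ∀ {S} → S ∈ map (false ∷_) (vertices n A) × S ∈ map (true ∷_) (vertices n (A ∘ suc)) → _
  disjoint (i , j) with ∈-map⁻ _ i | ∈-map⁻ _ j
  ... | _ , _ , refl | _ , _ , ()

unique-↭ : ∀ {a} {X : Set a} {xs ys : List X} → Unique xs → Unique ys →
  (∀ {z} → z ∈ xs → z ∈ ys) → (∀ {z} → z ∈ ys → z ∈ xs) → xs ↭ ys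
unique-↭ u v f g = ∼bag⇒↭ (unique∧set⇒bag u v (mk⇔ f g))

Adj-irrefl : ∀ {n} {A : Levels} {S T : Subset n} → Adj A S T → S ≢ T
Adj-irrefl {S = S} (_ , _ , inj₁ (_ , c)) refl =
  1+n≢n (trans c (cong ∣_∣ (sym (∩-idem S))))
Adj-irrefl (_ , _ , inj₂ (inj₁ (lt , _))) refl = <-irrefl refl lt
Adj-irrefl (_ , _ , inj₂ (inj₂ (lt , _))) refl = <-irrefl refl lt

module _ {n : ℕ} where
  open CommutativeMonoidSolver (++-commutativeMonoid {A = Subset n}) public using (solve; _⊜_; _⊕_)

module Glue {n : ℕ} {A : Levels} (H : ∀ b → HamConnected n (half b A)) where

  lift : Bool → List (Subset n) → List (Subset (suc n))
  lift b = map (b ∷_)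

  other : Bool → List (Subset (suc n))
  other b = lift (not b) (vertices n (half (not b) A))

  rejoin : ∀ b (T R : Subset n) → IsVertex (half b A) T → IsVertex (half b A) R →
    Avoids (half b A) R T → HamPath (half b A) T R
  rejoin b T R vT vR (inj₁ ≢) = H b vT vR ≢
  rejoin b T R vT vR (inj₂ (refl , only)) = T ∷ [] , single vT ,
    unique-↭ ([] ∷ []) (vertices-unique n _) (λ { (here refl) → ∈-vertices T vT })
      (λ {Z} i → here (only Z (vertices-sound n i)))

  -- The first edge of the walk, from `u` to `w`, is replaced by a link to `u′`, a Hamilton path of
  -- the other half from `u′` to `w′`, and a link back to `w`. Distinct ends guarantee that there is
  -- such an edge.
  detour : ∀ b {u v p} → Walk (half b A) u v p → u ≢ v →
    ∃ λ q → Walk A (b ∷ u) (b ∷ v) q × q ↭ lift b p ++ other b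
  detour b (single _) u≢u = ⊥-elim (u≢u refl)
  detour b {u} (step {w = w} {p = p} e W) _
    with fork b u w (proj₁ e) (proj₁ (proj₂ e)) (Adj-irrefl e)
  ... | u′ , w′ , c , d , av
    with rejoin (not b) w′ u′ (Link-target b w w′ d) (Link-target b u u′ c) av
  ...   | r′ , R′ , cr′ with HamPath-reverse (r′ , R′ , cr′)
  ...     | r , R , cr =
    (b ∷ u) ∷ (lift (not b) r ++ lift b p) ,
    step (Link⇒Adj b c) (Walk-join (Walk-∷ (not b) R) (Adj-sym (Link⇒Adj b d)) (Walk-∷ b W)) ,
    prep _ (↭-trans (++-comm (lift (not b) r) (lift b p)) (++⁺ˡ (lift b p) (↭-map⁺ _ cr)))

  -- The walk leaves its half at `s`, entering the other half at a vertex chosen by `reach` so that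
  -- a Hamilton path leads from there to `y`.
  extend : ∀ b {x s y p} → Walk (half b A) x s p → IsVertex (half b A) s → Inner b s →
    IsVertex (half (not b) A) y →
    ∃ λ q → Walk A (b ∷ x) (not b ∷ y) q × q ↭ lift b p ++ other b
  extend b {s = s} {y} {p} W vs inner vy with reach b s y vs inner vy
  ... | s′ , c , av with rejoin (not b) s′ y (Link-target b s s′ c) vy av
  ...   | r , R , cr = lift b p ++ lift (not b) r ,
    Walk-join (Walk-∷ b W) (Link⇒Adj b c) (Walk-∷ (not b) R) , ++⁺ˡ (lift b p) (↭-map⁺ _ cr)

  ham-same : ∀ b {u v} → IsVertex (half b A) u → IsVertex (half b A) v → u ≢ v →
    HamPath A (b ∷ u) (b ∷ v)
  ham-same b vu vv u≢v with H b vu vv u≢v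
  ... | p , W , c with detour b W u≢v
  ...   | q , Q , d = q , Q , ↭-trans d (vertices-split b c ↭-refl)

  ham-cross : ∀ b {u s v} → IsVertex (half b A) u → IsVertex (half (not b) A) v →
    IsVertex (half b A) s → Inner b s → u ≢ s → HamPath A (b ∷ u) (not b ∷ v)
  ham-cross b vu vv vs inner u≢s with H b vu vs u≢s
  ... | p , W , c with extend b W vs inner vv
  ...   | q , Q , d = q , Q , ↭-trans d (vertices-split b c ↭-refl)

  two-two : ∀ b {u v x y} → IsVertex (half b A) u → IsVertex (half b A) v → u ≢ v →
    IsVertex (half (not b) A) x → IsVertex (half (not b) A) y → x ≢ y →
    PairedCover A (b ∷ u) (b ∷ v) (not b ∷ x) (not b ∷ y)
  two-two b vu vv u≢v vx vy x≢y with H b vu vv u≢v | H (not b) vx vy x≢y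
  ... | p , W , c | q , V , d =
    lift b p , lift (not b) q , Walk-∷ b W , Walk-∷ (not b) V , vertices-split b c d

  four-zero : ∀ b {u v x y} → PairedCover (half b A) u v x y → u ≢ v →
    PairedCover A (b ∷ u) (b ∷ v) (b ∷ x) (b ∷ y)
  four-zero b (p , q , W , V , c) u≢v with detour b W u≢v
  ... | p′ , W′ , d = p′ , lift b q , W′ , Walk-∷ b V ,
    ↭-trans (++⁺ʳ _ d) (↭-trans
      (solve 3 (λ P O Q → (P ⊕ O) ⊕ Q ⊜ (P ⊕ Q) ⊕ O) ↭-refl (lift b p) (other b) (lift b q))
      (↭-trans (++⁺ʳ _ (↭-reflexive (sym (map-++ _ p q)))) (vertices-split b c ↭-refl)))

  three-one : ∀ b {u v x s y} → PairedCover (half b A) u v x s →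
    IsVertex (half b A) s → Inner b s → IsVertex (half (not b) A) y →
    PairedCover A (b ∷ u) (b ∷ v) (b ∷ x) (not b ∷ y)
  three-one b (p , q , W , V , c) vs inner vy with extend b V vs inner vy
  ... | q′ , V′ , d = lift b p , q′ , Walk-∷ b W , V′ ,
    ↭-trans (++⁺ˡ (lift b p) d) (↭-trans
      (solve 3 (λ P Q O → P ⊕ (Q ⊕ O) ⊜ (P ⊕ Q) ⊕ O) ↭-refl (lift b p) (lift b q) (other b))
      (↭-trans (++⁺ʳ _ (↭-reflexive (sym (map-++ _ p q)))) (vertices-split b c ↭-refl)))

  -- One path changes halves along the link from `s` to `s′`, the other along the link from `t` to
  -- `t′`.
  crossed : ∀ b {u v x y s s′ t t′} → Link A b s s′ → Link A b t t′ →
    PairedCover (half b A) u s x t → PairedCover (half (not b) A) s′ v t′ y →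
    PairedCover A (b ∷ u) (not b ∷ v) (b ∷ x) (not b ∷ y)
  crossed b ls lt (p , q , W , V , c) (p′ , q′ , W′ , V′ , c′) =
    lift b p ++ lift (not b) p′ , lift b q ++ lift (not b) q′ ,
    Walk-join (Walk-∷ b W) (Link⇒Adj b ls) (Walk-∷ (not b) W′) ,
    Walk-join (Walk-∷ b V) (Link⇒Adj b lt) (Walk-∷ (not b) V′) ,
    ↭-trans
      (solve 4 (λ P P′ Q Q′ → (P ⊕ P′) ⊕ (Q ⊕ Q′) ⊜ (P ⊕ Q) ⊕ (P′ ⊕ Q′)) ↭-refl
        (lift b p) (lift (not b) p′) (lift b q) (lift (not b) q′))
      (↭-trans (++⁺ (↭-reflexive (sym (map-++ _ p q))) (↭-reflexive (sym (map-++ _ p′ q′))))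
        (vertices-split b c c′))

  -- Serves a half that consists of the empty and the full set alone: both paths have length 0.
  two-vertices : ∀ {B v y} → IsVertex B v → IsVertex B y → v ≢ y →
    (∀ Z → IsVertex B Z → Z ≡ v ⊎ Z ≡ y) → PairedCover {n} B v v y y
  two-vertices {B} {v} {y} vv vy v≢y only =
    v ∷ [] , y ∷ [] , single vv , single vy ,
    unique-↭ ((v≢y ∷ []) ∷ [] ∷ []) (vertices-unique n B)
      (λ { (here refl) → ∈-vertices v vv ; (there (here refl)) → ∈-vertices y vy })
      (λ {Z} i → case only Z (vertices-sound n i) of λ
        { (inj₁ e) → here e ; (inj₂ e) → there (here e) })

-- Inner levels have room to avoid given sets

_∈?_ : ∀ {n} (S : Subset n) (F : List (Subset n)) → Dec (S ∈ F)
_∈?_ = DecMembership._∈?_ _≟ˢ_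

unique-length-≤ : ∀ {a} {X : Set a} {L F : List X} → Unique L →
  (∀ {z} → z ∈ L → z ∈ F) → length L ≤ length F
unique-length-≤ [] _ = z≤n
unique-length-≤ {L = x ∷ L} (x∉ ∷ u) f with ∈-∃++ (f (here refl))
... | as , bs , refl = ≤-trans (s≤s (unique-length-≤ u g)) (≤-reflexive (sym (↭-length (shift x as bs))))
  where
  g : ∀ {z} → z ∈ L → z ∈ as ++ bs
  g i with ∈-resp-↭ (shift x as bs) (f (there i))
  ... | here refl = ⊥-elim (All.lookup x∉ i refl)
  ... | there j   = j

pigeonhole : ∀ {n} {L F : List (Subset n)} → Unique L → length F < length L → ∃ λ S → S ∈ L × S ∉ F
pigeonhole {L = L} {F} u lt with any? (λ S → ¬? (S ∈? F)) L
... | yes i = find i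
... | no ¬i = ⊥-elim (<⇒≱ lt (unique-length-≤ u
  λ {z} i → decidable-stable (z ∈? F) (All.lookup (¬Any⇒All¬ L ¬i) i)))

only-level : ℕ → Levels
only-level k j = j ≡ᵇ k

length-vertices : ∀ n A →
  length (vertices (suc n) A) ≡ length (vertices n A) + length (vertices n (A ∘ suc))
length-vertices n A = trans (length-++ (map (false ∷_) (vertices n A)))
  (cong₂ _+_ (length-map _ (vertices n A)) (length-map _ (vertices n (A ∘ suc))))

level-nonempty : ∀ {n k} → k ≤ n → 1 ≤ length (vertices n (only-level k))
level-nonempty {zero} z≤n = ≤-refl
level-nonempty {suc n} {k} k≤ rewrite length-vertices n (only-level k) with k
... | zero  = ≤-trans (level-nonempty {n} z≤n) (m≤m+n _ _)
... | suc j = ≤-trans (level-nonempty (s≤s⁻¹ k≤)) (m≤n+m _ _)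

-- The length is a binomial coefficient and `length-vertices` gives Pascal's rule: by induction one
-- summand contributes all but one of the required sets and the other at least one.
level-large : ∀ {n k} → 0 < k → k < n → n ≤ length (vertices n (only-level k))
level-large {suc n} {suc k} 0<k k<n rewrite length-vertices n (only-level (suc k)) with suc k <? n
... | yes k<n′ = ≤-trans (≤-reflexive (+-comm 1 n))
                   (+-mono-≤ (level-large z<s k<n′) (level-nonempty (s≤s⁻¹ (<⇒≤ k<n))))
level-large {suc n} {suc zero} 0<k k<n | no k≮ =
  ≤-trans (s≤s (≮⇒≥ k≮)) (+-mono-≤ (level-nonempty (s≤s⁻¹ k<n)) (level-nonempty {n} z≤n))
level-large {suc n} {suc (suc k)} 0<k k<n | no k≮ =
  +-mono-≤ (level-nonempty (s≤s⁻¹ k<n)) (level-large z<s (s≤s⁻¹ k<n))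

avoid : ∀ {n k} → 0 < k → k < n → (F : List (Subset n)) → length F < n → ∃ λ S → ∣ S ∣ ≡ k × S ∉ F
avoid {n} {k} 0<k k<n F lt
  with pigeonhole (vertices-unique n (only-level k)) (<-≤-trans lt (level-large 0<k k<n))
... | S , S∈ , S∉ = S , ≡ᵇ⇒≡ ∣ S ∣ k (subst T (sym (vertices-sound n S∈)) _) , S∉

inner-level? : ∀ (B : Levels) n → (∃ λ k → 0 < k × k < n × B k ≡ true) ⊎ (∀ k → 0 < k → k < n → B k ≡ false)
inner-level? B zero = inj₂ λ _ _ ()
inner-level? B (suc n) with search (B ∘ suc) n
... | inj₁ (k , k<n , vk) = inj₁ (suc k , z<s , s<s k<n , vk)
... | inj₂ none           = inj₂ λ { (suc k) _ k<n → none k (s<s⁻¹ k<n) }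

level-inner : ∀ {n k} b (S : Subset n) → 0 < k → k < n → ∣ S ∣ ≡ k → Inner b S
level-inner false S 0<k k<n e e′ = <⇒≢ 0<k (trans (sym e′) e)
level-inner true  S 0<k k<n e e′ = <⇒≢ k<n (trans (sym e) e′)

extreme : ∀ {n} {B : Levels} (S : Subset n) → IsVertex B S →
  (∀ k → 0 < k → k < n → B k ≡ false) → S ≡ ⊥ ⊎ S ≡ ⊤
extreme {n} S vS none with ∣ S ∣ in e
... | zero = inj₁ (∣S∣≡0⇒S≡⊥ S e)
... | suc k with suc k ≟ n
...   | yes refl = inj₂ (∣p∣≡n⇒p≡⊤ e)
...   | no k≢n with () ← trans (sym vS) (none (suc k) z<s (≤∧≢⇒< (subst (_≤ n) e (∣p∣≤n S)) k≢n))

-- Hamilton connectedness: the induction step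

module _ {n : ℕ} {A : Levels} (2≤n : 2 ≤ n) (H : ∀ b → HamConnected n (half b A)) where
  open Glue H

  -- If some half has an inner level, that level supplies the vertex where the path changes halves.
  -- Otherwise only the empty and the full subset of the larger ground set can be vertices, and a
  -- single edge joins them.
  ham-step-cross : ∀ {u v : Subset n} → IsVertex A u → IsVertex (A ∘ suc) v →
    HamPath A (false ∷ u) (true ∷ v)
  ham-step-cross {u} {v} vu vv with inner-level? A n
  ... | inj₁ (k , 0<k , k<n , vk) with avoid 0<k k<n (u ∷ []) 2≤n
  ...   | s , e , s∉ =
    ham-cross false vu vv (trans (cong A e) vk) (level-inner false s 0<k k<n e) (s∉ ∘ here ∘ sym)
  ham-step-cross {u} {v} vu vv | inj₂ none with inner-level? (A ∘ suc) n
  ... | inj₁ (k , 0<k , k<n , vk) with avoid 0<k k<n (v ∷ []) 2≤n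
  ...   | s , e , s∉ = HamPath-reverse
    (ham-cross true vv vu (trans (cong (A ∘ suc) e) vk) (level-inner true s 0<k k<n e) (s∉ ∘ here ∘ sym))
  ham-step-cross {u} {v} vu vv | inj₂ none | inj₂ none′ =
    lift false (proj₁ P) ++ lift true (proj₁ Q) ,
    Walk-join (Walk-∷ false (proj₁ (proj₂ P)))
      (Link⇒Adj false (up {S = u} {v} u⊆v vu vv gap)) (Walk-∷ true (proj₁ (proj₂ Q))) ,
    vertices-split false (proj₂ (proj₂ P)) (proj₂ (proj₂ Q))
    where
    A-inner : ∀ k → 0 < k → k ≤ n → A k ≡ false
    A-inner k 0<k k≤n with k ≟ n
    ... | no k≢n = none k 0<k (≤∧≢⇒< k≤n k≢n)
    -- Level `n` of `A` is level `n` minus 1 of the half with the first point, which is inner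
    -- because `n` is at least 2.
    A-inner (suc k) _ k<n | yes refl = none′ k (s≤s⁻¹ 2≤n) ≤-refl
    lower : ∀ S → IsVertex A S → S ≡ ⊥
    lower S vS with ∣ S ∣ in e
    ... | zero  = ∣S∣≡0⇒S≡⊥ S e
    ... | suc k with () ← trans (sym vS) (A-inner (suc k) z<s (subst (_≤ n) e (∣p∣≤n S)))
    upper : ∀ S → IsVertex (A ∘ suc) S → S ≡ ⊤
    upper S vS with ∣ S ∣ ≟ n
    ... | yes e = ∣p∣≡n⇒p≡⊤ e
    ... | no ≢  with () ← trans (sym vS) (A-inner (suc ∣ S ∣) z<s (≤∧≢⇒< (∣p∣≤n S) ≢))
    u⊆v : u ⊆ v
    u⊆v = subst (u ⊆_) (sym (upper v vv)) (⊆-max u)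
    gap : ∀ k → ∣ u ∣ < k → k < suc ∣ v ∣ → A k ≡ false
    gap k l r = A-inner k (≤-<-trans z≤n l) (≤-trans (s≤s⁻¹ r) (∣p∣≤n v))
    P : HamPath A u u
    P = rejoin false u u vu vu (inj₂ (refl , λ Z vZ → trans (lower Z vZ) (sym (lower u vu))))
    Q : HamPath (A ∘ suc) v v
    Q = rejoin true v v vv vv (inj₂ (refl , λ Z vZ → trans (upper Z vZ) (sym (upper v vv))))

  ham-step : HamConnected (suc n) A
  ham-step {false ∷ u} {false ∷ v} vu vv u≢v = ham-same false vu vv (u≢v ∘ cong (false ∷_))
  ham-step {true ∷ u}  {true ∷ v}  vu vv u≢v = ham-same true vu vv (u≢v ∘ cong (true ∷_))
  ham-step {false ∷ u} {true ∷ v}  vu vv _   = ham-step-cross vu vv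
  ham-step {true ∷ u}  {false ∷ v} vu vv _   = HamPath-reverse (ham-step-cross vv vu)

-- Paired covers: distributing the terminals over the halves

FourthVertex : ∀ {n} → Levels → Set
FourthVertex {n} A = ∀ b {u v x : Subset n} →
  IsVertex (half b A) u → IsVertex (half b A) v → IsVertex (half b A) x → u ≢ v → u ≢ x → v ≢ x →
  ∃ λ s → IsVertex (half b A) s × Inner b s × u ≢ s × v ≢ s × x ≢ s

-- The case of both pairs split between the halves, normalised so that `u` and `x` avoid the first
-- point. It is a hypothesis of the step because it is proved differently for halves on 3 points and
-- for larger ones.
Crossing : ∀ {n} → Levels → Set
Crossing {n} A = ∀ {u v x y : Subset n} → IsVertex A u → IsVertex A x → u ≢ x →
  IsVertex (A ∘ suc) v → IsVertex (A ∘ suc) y → v ≢ y →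
  PairedCover A (false ∷ u) (true ∷ v) (false ∷ x) (true ∷ y)

module _ {n : ℕ} {A : Levels} (H : ∀ b → HamConnected n (half b A)) (P : ∀ b → PairedCoverable n (half b A))
         (fourth : FourthVertex {n} A) (crossing : Crossing {n} A) where
  open Glue H

  paired-4-0 : ∀ b {u v x y : Subset n} → Terminals A (b ∷ u) (b ∷ v) (b ∷ x) (b ∷ y) →
    PairedCover A (b ∷ u) (b ∷ v) (b ∷ x) (b ∷ y)
  paired-4-0 b {u} {v} {x} {y} (terminals vu vv vx vy uv ux uy vx′ vy′ xy) =
    four-zero b (P b (terminals (IsVertex-tail b u vu) (IsVertex-tail b v vv)
      (IsVertex-tail b x vx) (IsVertex-tail b y vy)
      (uv ∘ cong (b ∷_)) (ux ∘ cong (b ∷_)) (uy ∘ cong (b ∷_))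
      (vx′ ∘ cong (b ∷_)) (vy′ ∘ cong (b ∷_)) (xy ∘ cong (b ∷_)))) (uv ∘ cong (b ∷_))

  paired-3-1 : ∀ b {u v x y : Subset n} → Terminals A (b ∷ u) (b ∷ v) (b ∷ x) (not b ∷ y) →
    PairedCover A (b ∷ u) (b ∷ v) (b ∷ x) (not b ∷ y)
  paired-3-1 b {u} {v} {x} {y} (terminals vu vv vx vy uv ux uy vx′ vy′ xy)
    with fourth b (IsVertex-tail b u vu) (IsVertex-tail b v vv) (IsVertex-tail b x vx)
           (uv ∘ cong (b ∷_)) (ux ∘ cong (b ∷_)) (vx′ ∘ cong (b ∷_))
  ... | s , vs , inner , us , vs′ , xs =
    three-one b (P b (terminals (IsVertex-tail b u vu) (IsVertex-tail b v vv) (IsVertex-tail b x vx) vs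
      (uv ∘ cong (b ∷_)) (ux ∘ cong (b ∷_)) us (vx′ ∘ cong (b ∷_)) vs′ xs))
      vs inner (IsVertex-tail (not b) y vy)

  paired-2-2 : ∀ b {u v x y : Subset n} → Terminals A (b ∷ u) (b ∷ v) (not b ∷ x) (not b ∷ y) →
    PairedCover A (b ∷ u) (b ∷ v) (not b ∷ x) (not b ∷ y)
  paired-2-2 b {u} {v} {x} {y} (terminals vu vv vx vy uv ux uy vx′ vy′ xy) =
    two-two b (IsVertex-tail b u vu) (IsVertex-tail b v vv) (uv ∘ cong (b ∷_))
      (IsVertex-tail (not b) x vx) (IsVertex-tail (not b) y vy) (xy ∘ cong (not b ∷_))

  paired-same : ∀ b c d {u v x y : Subset n} → Terminals A (b ∷ u) (b ∷ v) (c ∷ x) (d ∷ y) →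
    PairedCover A (b ∷ u) (b ∷ v) (c ∷ x) (d ∷ y)
  paired-same false false false t = paired-4-0 false t
  paired-same true  true  true  t = paired-4-0 true t
  paired-same false true  true  t = paired-2-2 false t
  paired-same true  false false t = paired-2-2 true t
  paired-same false false true  t = paired-3-1 false t
  paired-same true  true  false t = paired-3-1 true t
  paired-same false true  false t = PairedCover-flip (paired-3-1 false (Terminals-flip t))
  paired-same true  false true  t = PairedCover-flip (paired-3-1 true (Terminals-flip t))

  paired-crossed : ∀ c {u v x y : Subset n} → Terminals A (false ∷ u) (true ∷ v) (c ∷ x) (not c ∷ y) →
    PairedCover A (false ∷ u) (true ∷ v) (c ∷ x) (not c ∷ y)
  paired-crossed false (terminals vu vv vx vy _ ux _ _ vy′ _) =
    crossing vu vx (ux ∘ cong (false ∷_)) vv vy (vy′ ∘ cong (true ∷_))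
  paired-crossed true t = PairedCover-flip (paired-crossed false (Terminals-flip t))

  paired-crossed′ : ∀ c {u v x y : Subset n} → Terminals A (true ∷ u) (false ∷ v) (c ∷ x) (not c ∷ y) →
    PairedCover A (true ∷ u) (false ∷ v) (c ∷ x) (not c ∷ y)
  paired-crossed′ c t = PairedCover-swap (PairedCover-flip (PairedCover-swap
    (paired-crossed c (Terminals-swap (Terminals-flip (Terminals-swap t))))))

  -- Either some pair lies in one half, and swapping the pairs makes it the first, or both pairs are
  -- split, and reversing paths brings them to the form of `Crossing`.
  paired-step : PairedCoverable (suc n) A
  paired-step {false ∷ _} {false ∷ _} {c ∷ _}     {d ∷ _}     t = paired-same false c d t
  paired-step {true ∷ _}  {true ∷ _}  {c ∷ _}     {d ∷ _}     t = paired-same true c d t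
  paired-step {b ∷ _}     {d ∷ _}     {false ∷ _} {false ∷ _} t =
    PairedCover-swap (paired-same false b d (Terminals-swap t))
  paired-step {b ∷ _}     {d ∷ _}     {true ∷ _}  {true ∷ _}  t =
    PairedCover-swap (paired-same true b d (Terminals-swap t))
  paired-step {false ∷ _} {true ∷ _}  {false ∷ _} {true ∷ _}  t = paired-crossed false t
  paired-step {false ∷ _} {true ∷ _}  {true ∷ _}  {false ∷ _} t = paired-crossed true t
  paired-step {true ∷ _}  {false ∷ _} {false ∷ _} {true ∷ _}  t = paired-crossed′ false t
  paired-step {true ∷ _}  {false ∷ _} {true ∷ _}  {false ∷ _} t = paired-crossed′ true t

-- An inner level has at least `n` sets, hence one besides the three given. Without an inner level
-- the half has only two possible vertices, too few for three distinct ones.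
fourth-vertex : ∀ {n} {A : Levels} → 4 ≤ n → FourthVertex {n} A
fourth-vertex {n} {A} 4≤n b {u} {v} {x} vu vv vx u≢v u≢x v≢x with inner-level? (half b A) n
... | inj₁ (k , 0<k , k<n , vk) with avoid 0<k k<n (u ∷ v ∷ x ∷ []) 4≤n
...   | s , e , s∉ = s , trans (cong (half b A) e) vk , level-inner b s 0<k k<n e ,
  (λ { refl → s∉ (here refl) }) , (λ { refl → s∉ (there (here refl)) }) ,
  (λ { refl → s∉ (there (there (here refl))) })
fourth-vertex {A = A} 4≤n b {u} {v} {x} vu vv vx u≢v u≢x v≢x | inj₂ none
  with extreme {B = half b A} u vu none | extreme {B = half b A} v vv none | extreme {B = half b A} x vx none
... | inj₁ refl | inj₁ refl | _         = ⊥-elim (u≢v refl)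
... | inj₂ refl | inj₂ refl | _         = ⊥-elim (u≢v refl)
... | inj₁ refl | inj₂ refl | inj₁ refl = ⊥-elim (u≢x refl)
... | inj₁ refl | inj₂ refl | inj₂ refl = ⊥-elim (v≢x refl)
... | inj₂ refl | inj₁ refl | inj₁ refl = ⊥-elim (v≢x refl)
... | inj₂ refl | inj₁ refl | inj₂ refl = ⊥-elim (u≢x refl)

-- Two disjoint edges between the halves

∣++∣ : ∀ {w r} (S : Subset w) (R : Subset r) → ∣ S ++ᵛ R ∣ ≡ ∣ S ∣ + ∣ R ∣
∣++∣ []          R = refl
∣++∣ (false ∷ S) R = ∣++∣ S R
∣++∣ (true ∷ S)  R = cong suc (∣++∣ S R)

++-⊆ : ∀ {w r} (S T : Subset w) {R Q : Subset r} → S ⊆ T → R ⊆ Q → S ++ᵛ R ⊆ T ++ᵛ Q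
++-⊆ []          []          S⊆T R⊆Q = R⊆Q
++-⊆ (false ∷ S) (_ ∷ T)     S⊆T R⊆Q = out⊆ (++-⊆ S T (drop-∷-⊆ S⊆T) R⊆Q)
++-⊆ (true ∷ S)  (true ∷ T)  S⊆T R⊆Q = in⊆in (++-⊆ S T (drop-∷-⊆ S⊆T) R⊆Q)
++-⊆ (true ∷ S)  (false ∷ T) S⊆T R⊆Q with () ← S⊆T here

level : ∀ w → ℕ → List (Subset w)
level w k = vertices w (only-level k)

level₂ : ∀ w → ℕ → ℕ → List (Subset w)
level₂ w k l = vertices w (λ j → (j ≡ᵇ k) ∨ (j ≡ᵇ l))

-- `Robust` only quantifies over deletions inside `L`. Something outside `L` deletes nothing from
-- it, so any member `z` may take its place.
nearest : ∀ {w} {L : List (Subset w)} {z} → z ∈ L → ∀ u →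
  ∃ λ u′ → u′ ∈ L × (∀ {s} → s ∈ L → s ≢ u′ → s ≢ u)
nearest {L = L} {z} z∈L u with u ∈? L
... | yes u∈L = u , u∈L , λ _ ≢ → ≢
... | no u∉L  = z , z∈L , λ { s∈L _ refl → u∉L s∈L }

module _ {w : ℕ} (E : Subset w → Subset w → Set) where

  Free : (u x v y s s′ : Subset w) → Set
  Free u x v y s s′ = E s s′ × s ≢ u × s ≢ x × s′ ≢ v × s′ ≢ y

  TwoFree : (L L′ : List (Subset w)) → (u x v y : Subset w) → Set
  TwoFree L L′ u x v y =
    Any (λ s → Any (λ s′ → Free u x v y s s′ ×
      Any (λ t → s ≢ t × Any (λ t′ → s′ ≢ t′ × Free u x v y t t′) L′) L) L′) L

  -- E has two disjoint edges between L and L′ that survive the deletion of any two elements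
  -- on each side.
  record Robust (L L′ : List (Subset w)) : Set where
    constructor robust
    field
      twoFree : All (λ u → All (λ x → All (λ v → All (λ y → TwoFree L L′ u x v y) L′) L′) L) L

module _ {w : ℕ} {E : Subset w → Subset w → Set} where

  robust? : (∀ s s′ → Dec (E s s′)) → ∀ L L′ → Dec (Robust E L L′)
  robust? E? L L′ = map′ robust Robust.twoFree
    (all? (λ u → all? (λ x → all? (λ v → all? (λ y → twoFree? u x v y) L′) L′) L) L)
    where
    free? : ∀ u x v y s s′ → Dec (Free E u x v y s s′)
    free? u x v y s s′ =
      E? s s′ ×-dec ¬? (s ≟ˢ u) ×-dec ¬? (s ≟ˢ x) ×-dec ¬? (s′ ≟ˢ v) ×-dec ¬? (s′ ≟ˢ y)
    twoFree? : ∀ u x v y → Dec (TwoFree E L L′ u x v y)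
    twoFree? u x v y =
      any? (λ s → any? (λ s′ → free? u x v y s s′ ×-dec
        any? (λ t → ¬? (s ≟ˢ t) ×-dec any? (λ t′ → ¬? (s′ ≟ˢ t′) ×-dec free? u x v y t t′) L′) L) L′) L

  two-free : ∀ {L L′ z z′} → Robust E L L′ → z ∈ L → z′ ∈ L′ → ∀ u x v y →
    ∃ λ s → ∃ λ s′ → ∃ λ t → ∃ λ t′ → Free E u x v y s s′ × Free E u x v y t t′ × s ≢ t × s′ ≢ t′
  two-free (robust all) z∈ z′∈ u x v y
    with nearest z∈ u | nearest z∈ x | nearest z′∈ v | nearest z′∈ y
  ... | u₁ , u∈ , fu | x₁ , x∈ , fx | v₁ , v∈ , fv | y₁ , y∈ , fy
    with find (All.lookup (All.lookup (All.lookup (All.lookup all u∈) x∈) v∈) y∈)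
  ... | s , s∈ , i with find i
  ... | s′ , s′∈ , (e , su , sx , sv , sy) , j with find j
  ... | t , t∈ , s≢t , k with find k
  ... | t′ , t′∈ , s′≢t′ , (e′ , tu , tx , tv , ty) = s , s′ , t , t′ ,
    (e , fu s∈ su , fx s∈ sx , fv s′∈ sv , fy s′∈ sy) ,
    (e′ , fu t∈ tu , fx t∈ tx , fv t′∈ tv , fy t′∈ ty) , s≢t , s′≢t′

-- `Down` and `Leap` are the traces of `same` and `up` on a window of `w` points. The `suc` in
-- `Leap` accounts for the first point, which the upper set contains.
Down : ∀ {w} → ℕ → Subset w → Subset w → Set
Down m s s′ = s′ ⊆ s × ∣ s ∣ ≡ suc m × ∣ s′ ∣ ≡ m

down? : ∀ {w} m (s s′ : Subset w) → Dec (Down m s s′)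
down? m s s′ = s′ ⊆? s ×-dec ∣ s ∣ ≟ suc m ×-dec ∣ s′ ∣ ≟ m

Leap : ∀ {w} → ℕ → ℕ → Subset w → Subset w → Set
Leap k l s s′ = s ⊆ s′ × ∣ s ∣ ≡ k × suc ∣ s′ ∣ ≡ l

leap? : ∀ {w} k l (s s′ : Subset w) → Dec (Leap k l s s′)
leap? k l s s′ = s ⊆? s′ ×-dec ∣ s ∣ ≟ k ×-dec suc ∣ s′ ∣ ≟ l

TwoLevels : ∀ {w} → ℕ → ℕ → Subset w → Subset w → Set
TwoLevels k l s s′ = (s′ ⊆ s × ∣ s ∣ ≡ suc ∣ s′ ∣ × (∣ s ∣ ≡ k ⊎ ∣ s ∣ ≡ l)) ⊎ Leap k l s s′

twoLevels? : ∀ {w} k l (s s′ : Subset w) → Dec (TwoLevels k l s s′)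
twoLevels? k l s s′ =
  (s′ ⊆? s ×-dec ∣ s ∣ ≟ suc ∣ s′ ∣ ×-dec (∣ s ∣ ≟ k ⊎-dec ∣ s ∣ ≟ l)) ⊎-dec leap? k l s s′

abstract
  -- The robustness statements are decided by evaluation. Four points allow a single level: it keeps
  -- at least two sets after two deletions.
  down-1 : Robust {4} (Down 1) (level 4 2) (level 4 1)
  down-1 = toWitness {a? = robust? (down? 1) (level 4 2) (level 4 1)} _

  down-2 : Robust {4} (Down 2) (level 4 3) (level 4 2)
  down-2 = toWitness {a? = robust? (down? 2) (level 4 3) (level 4 2)} _

  leap-1-4 : Robust {4} (Leap 1 4) (level 4 1) (level 4 3)
  leap-1-4 = toWitness {a? = robust? (leap? 1 4) (level 4 1) (level 4 3)} _

  -- On three points a level has at most three sets, so two deletions may leave only one; two levels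
  -- are therefore used together.
  twoLevels-1-2 : Robust {3} (TwoLevels 1 2) (level₂ 3 1 2) (level₂ 3 0 1)
  twoLevels-1-2 = toWitness {a? = robust? (twoLevels? 1 2) (level₂ 3 1 2) (level₂ 3 0 1)} _

  twoLevels-2-3 : Robust {3} (TwoLevels 2 3) (level₂ 3 2 3) (level₂ 3 1 2)
  twoLevels-2-3 = toWitness {a? = robust? (twoLevels? 2 3) (level₂ 3 2 3) (level₂ 3 1 2)} _

  twoLevels-1-3 : Robust {3} (TwoLevels 1 3) (level₂ 3 1 3) (level₂ 3 0 2)
  twoLevels-1-3 = toWitness {a? = robust? (twoLevels? 1 3) (level₂ 3 1 3) (level₂ 3 0 2)} _

-- Both paths change halves

PairedCover-reverse : ∀ {n} {A : Levels} {u v x y : Subset n} →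
  PairedCover A u v x y → PairedCover A v u y x
PairedCover-reverse c = PairedCover-swap (PairedCover-flip (PairedCover-swap (PairedCover-flip c)))

exhaust : ∀ {a} {X : Set a} {p q v y z : X} → v ≡ p ⊎ v ≡ q → y ≡ p ⊎ y ≡ q → z ≡ p ⊎ z ≡ q →
  v ≢ y → z ≡ v ⊎ z ≡ y
exhaust (inj₁ refl) (inj₁ refl) _           v≢y = ⊥-elim (v≢y refl)
exhaust (inj₂ refl) (inj₂ refl) _           v≢y = ⊥-elim (v≢y refl)
exhaust (inj₁ refl) (inj₂ refl) (inj₁ refl) _   = inj₁ refl
exhaust (inj₁ refl) (inj₂ refl) (inj₂ refl) _   = inj₂ refl
exhaust (inj₂ refl) (inj₁ refl) (inj₁ refl) _   = inj₂ refl
exhaust (inj₂ refl) (inj₁ refl) (inj₂ refl) _   = inj₁ refl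

∣S∣≡0⇒S⊆T : ∀ {n} (S T : Subset n) → ∣ S ∣ ≡ 0 → S ⊆ T
∣S∣≡0⇒S⊆T S T e = subst (_⊆ T) (sym (∣S∣≡0⇒S≡⊥ S e)) (⊆-min T)

∣S∣≡n⇒T⊆S : ∀ {n} (S T : Subset n) → ∣ S ∣ ≡ n → T ⊆ S
∣S∣≡n⇒T⊆S S T e = subst (T ⊆_) (sym (∣p∣≡n⇒p≡⊤ e)) (⊆-max T)

extreme-size : ∀ {n} {S : Subset n} → S ≡ ⊥ ⊎ S ≡ ⊤ → ∣ S ∣ ≡ 0 ⊎ ∣ S ∣ ≡ n
extreme-size {n} (inj₁ refl) = inj₁ (∣⊥∣≡0 n)
extreme-size {n} (inj₂ refl) = inj₂ (∣⊤∣≡n n)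

two-avoiding : ∀ {n k} → 4 ≤ n → 0 < k → k < n → (a b : Subset n) → ∃ λ s → ∃ λ t →
  ∣ s ∣ ≡ k × ∣ t ∣ ≡ k × s ≢ t × s ≢ a × s ≢ b × t ≢ a × t ≢ b
two-avoiding 4≤n 0<k k<n a b with avoid 0<k k<n (a ∷ b ∷ []) (≤-trans (n≤1+n 3) 4≤n)
... | s , es , s∉ with avoid 0<k k<n (a ∷ b ∷ s ∷ []) 4≤n
...   | t , et , t∉ = s , t , es , et , (λ { refl → t∉ (there (there (here refl))) }) ,
  s∉ ∘ here , s∉ ∘ there ∘ here , t∉ ∘ here , t∉ ∘ there ∘ here

module Cross-step {n : ℕ} {A : Levels} (H : ∀ b → HamConnected n (half b A))
    (P : ∀ b → PairedCoverable n (half b A)) where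
  open Glue H

  -- `s` and `t` become temporary ends in one half, `s′` and `t′` in the other. Disjointness of the
  -- links and avoidance of the terminals make the four ends distinct in each half.
  crossing-links : ∀ {u v x y s s′ t t′ : Subset n} → IsVertex A u → IsVertex A x → u ≢ x →
    IsVertex (A ∘ suc) v → IsVertex (A ∘ suc) y → v ≢ y →
    Cross A s s′ → Cross A t t′ → s ≢ t → s′ ≢ t′ →
    s ≢ u → s ≢ x → t ≢ u → t ≢ x → s′ ≢ v → s′ ≢ y → t′ ≢ v → t′ ≢ y →
    PairedCover A (false ∷ u) (true ∷ v) (false ∷ x) (true ∷ y)
  crossing-links {s = s} {s′} {t} {t′} vu vx u≢x vv vy v≢y c d s≢t s′≢t′ su sx tu tx s′v s′y t′v t′y =
    crossed false c d
      (P false (terminals vu (Link-target true s′ s c) vx (Link-target true t′ t d)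
        (≢-sym su) u≢x (≢-sym tu) sx s≢t (≢-sym tx)))
      (P true (terminals (Link-target false s s′ c) vv (Link-target false t t′ d) vy
        s′v s′≢t′ s′y (≢-sym t′v) v≢y (≢-sym t′y ∘ sym)))

  -- Every S in half b of size k is linked to both v and y, the only vertices of the other half.
  crossing-extremes : ∀ b {k} → 4 ≤ n → 0 < k → k < n → half b A k ≡ true →
    (∀ Z → IsVertex (half (not b) A) Z → Z ≡ ⊥ ⊎ Z ≡ ⊤) →
    (∀ S Z → ∣ S ∣ ≡ k → IsVertex (half (not b) A) Z → ∣ Z ∣ ≡ 0 ⊎ ∣ Z ∣ ≡ n → Link A b S Z) →
    ∀ {u v x y} → IsVertex (half b A) u → IsVertex (half b A) x → u ≢ x →
    IsVertex (half (not b) A) v → IsVertex (half (not b) A) y → v ≢ y →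
    PairedCover A (b ∷ u) (not b ∷ v) (b ∷ x) (not b ∷ y)
  crossing-extremes b 4≤n 0<k k<n vk ends link {u} {v} {x} {y} vu vx u≢x vv vy v≢y
    with two-avoiding 4≤n 0<k k<n u x
  ... | s , t , es , et , s≢t , su , sx , tu , tx =
    crossed b (link s v es vv (extreme-size (ends v vv))) (link t y et vy (extreme-size (ends y vy)))
      (P b (terminals vu (trans (cong (half b A) es) vk) vx (trans (cong (half b A) et) vk)
        (≢-sym su) u≢x (≢-sym tu) sx s≢t (≢-sym tx)))
      (two-vertices vv vy v≢y (λ Z vZ → exhaust (ends v vv) (ends y vy) (ends Z vZ) v≢y))

  -- With levels 2 to `n` unoccupied, the half with the first point has at most the empty and the
  -- full set. A singleton exchanges to the former and lies below the latter.
  crossing-bottom : 4 ≤ n → A 1 ≡ true → (∀ k → 1 < k → k ≤ n → A k ≡ false) → Crossing {n} A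
  crossing-bottom 4≤n v1 none = crossing-extremes false 4≤n z<s (≤-trans (s≤s (s≤s z≤n)) 4≤n) v1
    (λ Z vZ → extreme {B = A ∘ suc} Z vZ (λ k 0<k k<n → none (suc k) (s<s 0<k) k<n)) link
    where
    link : ∀ S Z → ∣ S ∣ ≡ 1 → IsVertex (A ∘ suc) Z → ∣ Z ∣ ≡ 0 ⊎ ∣ Z ∣ ≡ n → Cross A S Z
    link S Z e vZ (inj₁ z) = same (∣S∣≡0⇒S⊆T Z S z) (trans e (cong suc (sym z))) (trans (cong A e) v1)
    link S Z e vZ (inj₂ z) = up (∣S∣≡n⇒T⊆S Z S z) (trans (cong A e) v1) vZ
      λ k l r → none k (subst (_< k) e l) (≤-trans (s≤s⁻¹ r) (∣p∣≤n Z))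

  -- The mirror image of `crossing-bottom`: the sets missing one point, in the half with the first
  -- point, are linked to the two extreme sets of the other half.
  crossing-top : 4 ≤ n → A n ≡ true → (∀ k → 0 < k → k < n → A k ≡ false) → Crossing {n} A
  crossing-top 4≤n vn none vu vx u≢x vv vy v≢y = PairedCover-reverse
    (crossing-extremes true 4≤n (s≤s⁻¹ 1<n) (≤-reflexive 1+k≡n) (trans (cong A 1+k≡n) vn)
      (λ Z vZ → extreme {B = A} Z vZ none) link vv vy v≢y vu vx u≢x)
    where
    1<n : 1 < suc (pred n)
    1<n = ≤-trans (≤-trans (s≤s (s≤s z≤n)) 4≤n)
      (≤-reflexive (sym (suc-pred n {{>-nonZero (≤-trans z<s 4≤n)}})))
    1+k≡n : suc (pred n) ≡ n
    1+k≡n = suc-pred n {{>-nonZero (≤-trans z<s 4≤n)}}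
    link : ∀ S Z → ∣ S ∣ ≡ pred n → IsVertex A Z → ∣ Z ∣ ≡ 0 ⊎ ∣ Z ∣ ≡ n → Cross A Z S
    link S Z e vZ (inj₁ z) = up (∣S∣≡0⇒S⊆T Z S z) vZ (trans (cong A (trans (cong suc e) 1+k≡n)) vn)
      λ k l r → none k (≤-<-trans z≤n l) (<-≤-trans r (≤-reflexive (trans (cong suc e) 1+k≡n)))
    link S Z e vZ (inj₂ z) = same (∣S∣≡n⇒T⊆S Z S z) (trans z (sym (trans (cong suc e) 1+k≡n))) vZ

take-≢ : ∀ {w r} (S : Subset w) (R : Subset r) U → S ≢ take w U → S ++ᵛ R ≢ U
take-≢ {w} S R U ≢ e = ≢ (sym (++-injectiveˡ (take w U) S (trans (take++drop≡id w U) (sym e))))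

module Window {w r : ℕ} {A : Levels} (H : ∀ b → HamConnected (w + r) (half b A))
    (P : ∀ b → PairedCoverable (w + r) (half b A)) where
  open Cross-step H P

  -- Only the first `w` coordinates vary. A set that differs from a terminal there differs from it
  -- altogether, so it suffices to avoid the traces of the terminals on the window.
  crossing-window : ∀ {E L L′ z z′} →
    Robust E L L′ → z ∈ L → z′ ∈ L′ → (R R′ : Subset r) →
    (∀ s s′ → E s s′ → Cross A (s ++ᵛ R) (s′ ++ᵛ R′)) → Crossing {w + r} A
  crossing-window all z∈ z′∈ R R′ cross {u} {v} {x} {y} vu vx u≢x vv vy v≢y =
    let s , s′ , t , t′ , (e , su , sx , sv , sy) , (e′ , tu , tx , tv , ty) , s≢t , s′≢t′ =
          two-free all z∈ z′∈ (take w u) (take w x) (take w v) (take w y) in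
    crossing-links {u} {v} {x} {y} {s ++ᵛ R} {s′ ++ᵛ R′} {t ++ᵛ R} {t′ ++ᵛ R′}
      vu vx u≢x vv vy v≢y (cross s s′ e) (cross t t′ e′)
      (s≢t ∘ ++-injectiveˡ s t) (s′≢t′ ∘ ++-injectiveˡ s′ t′)
      (take-≢ s R u su) (take-≢ s R x sx) (take-≢ t R u tu) (take-≢ t R x tx)
      (take-≢ s′ R′ v sv) (take-≢ s′ R′ y sy) (take-≢ t′ R′ v tv) (take-≢ t′ R′ y ty)

  crossing-down : ∀ {m L L′ z z′} → Robust (Down m) L L′ → z ∈ L → z′ ∈ L′ →
    ∀ {j} → j ≤ r → A (suc m + j) ≡ true → Crossing {w + r} A
  crossing-down {m} all z∈ z′∈ {j} j≤r vj
    with enlarge ⊥ (≤-trans (≤-reflexive (∣⊥∣≡0 r)) z≤n) j≤r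
  ... | R , _ , c = crossing-window all z∈ z′∈ R R cross
    where
    size : ∀ s {k} → ∣ s ∣ ≡ k → ∣ s ++ᵛ R ∣ ≡ k + j
    size s e = trans (∣++∣ s R) (cong₂ _+_ e c)
    cross : ∀ s s′ → Down m s s′ → Cross A (s ++ᵛ R) (s′ ++ᵛ R)
    cross s s′ (s′⊆s , e , e′) = same (++-⊆ s′ s s′⊆s ⊆-refl)
      (trans (size s e) (cong suc (sym (size s′ e′)))) (trans (cong A (size s e)) vj)

module _ {r : ℕ} {A : Levels} (H : ∀ b → HamConnected (4 + r) (half b A))
    (P : ∀ b → PairedCoverable (4 + r) (half b A)) where
  open Cross-step H P
  open Window {4} {r} {A} H P

  -- Outside the window the lower set is empty and the upper set full. Window sizes 1 and 3 thus
  -- become 1 and `3 + r`, and the first point raises the latter to level `4 + r`.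
  crossing-leap : A 1 ≡ true → A (4 + r) ≡ true → (∀ k → 1 < k → k < 4 + r → A k ≡ false) →
    Crossing {4 + r} A
  crossing-leap v1 vn none = crossing-window leap-1-4 (here refl) (here refl) (⊥ {r}) ⊤ cross
    where
    cross : ∀ s s′ → Leap 1 4 s s′ → Cross A (s ++ᵛ ⊥ {r}) (s′ ++ᵛ ⊤)
    cross s s′ (s⊆s′ , e , e′) = up (++-⊆ s s′ s⊆s′ (⊆-max ⊥))
      (trans (cong A size) v1) (trans (cong A size′) vn)
      λ k l h → none k (subst (_< k) size l) (subst (k <_) size′ h)
      where
      size : ∣ s ++ᵛ ⊥ {r} ∣ ≡ 1
      size = trans (∣++∣ s ⊥) (cong₂ _+_ e (∣⊥∣≡0 r))
      size′ : suc ∣ s′ ++ᵛ ⊤ {r} ∣ ≡ 4 + r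
      size′ = trans (cong suc (∣++∣ s′ ⊤)) (cong₂ _+_ e′ (∣⊤∣≡n r))

  -- An occupied level from 2 to `3 + r` gives two disjoint exchanges within that level. Otherwise
  -- the cases depend on which of the levels 1 and `4 + r` are occupied.
  crossing-step : Crossing {4 + r} A
  crossing-step with search (A ∘ suc ∘ suc) (2 + r)
  ... | inj₁ (k , k<2+r , vk) with k ≤? r
  -- Window level 2 with `k` further points reaches levels 2 to `2 + r`; the remaining level `3 + r`
  -- is window level 3 with all `r` further points.
  ...   | yes k≤r = crossing-down down-1 (here refl) (here refl) k≤r vk
  ...   | no k≰r  = crossing-down down-2 (here refl) (here refl) ≤-refl
    (trans (cong (A ∘ suc ∘ suc) (≤-antisym (≰⇒> k≰r) (s≤s⁻¹ k<2+r))) vk)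
  crossing-step | inj₂ none = split (A 1) (A (4 + r)) refl refl
    where
    gap : ∀ k → 1 < k → k < 4 + r → A k ≡ false
    gap (suc (suc k)) _ k< = none k (s<s⁻¹ (s<s⁻¹ k<))
    gap (suc zero) (s≤s ()) _
    split : ∀ p q → A 1 ≡ p → A (4 + r) ≡ q → Crossing {4 + r} A
    split true true e f = crossing-leap e f gap
    split true false e f = crossing-bottom (s≤s (s≤s (s≤s (s≤s z≤n)))) e below
      where
      below : ∀ k → 1 < k → k ≤ 4 + r → A k ≡ false
      below k 1<k k≤ with k ≟ 4 + r
      ... | yes refl = f
      ... | no ≢     = gap k 1<k (≤∧≢⇒< k≤ ≢)
    split false true e f = crossing-top (s≤s (s≤s (s≤s (s≤s z≤n)))) f inner
      where
      inner : ∀ k → 0 < k → k < 4 + r → A k ≡ false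
      inner (suc zero)    _ _  = e
      inner (suc (suc k)) _ k< = gap (suc (suc k)) (s≤s (s≤s z≤n)) k<
    -- Only levels 0 and `5 + r` can be occupied, so the half of `u` and `x` has one vertex,
    -- contrary to `u ≢ x`.
    split false false e f {u} {x = x} vu vx u≢x _ _ _ = ⊥-elim (u≢x (trans (empty u vu) (sym (empty x vx))))
      where
      empty : ∀ S → IsVertex A S → S ≡ ⊥
      empty S vS with ∣ S ∣ in c
      ... | zero  = ∣S∣≡0⇒S≡⊥ S c
      ... | suc zero with () ← trans (sym vS) e
      empty S vS | suc (suc k) with suc (suc k) ≟ 4 + r
      ...   | yes refl with () ← trans (sym vS) f
      empty S vS | suc (suc k) | no ≢
        with () ← trans (sym vS) (gap (suc (suc k)) (s≤s (s≤s z≤n))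
          (≤∧≢⇒< (subst (_≤ 4 + r) c (∣p∣≤n S)) ≢))

-- Exhaustive search

consecIncl? : ∀ {n} (A : Levels) (S T : Subset n) → Dec (ConsecIncl A S T)
consecIncl? A S T = ∣ S ∣ <? ∣ T ∣ ×-dec gap? ×-dec S ⊆? T
  where
  gap? : Dec (∀ k → ∣ S ∣ < k → k < ∣ T ∣ → A k ≡ false)
  gap? = map′ (λ f k l r → f {k} r l) (λ f {k} r l → f k l r)
    (allUpTo? (λ k → ∣ S ∣ <? k →-dec A k ≟ᵇ false) ∣ T ∣)

adj? : ∀ {n} (A : Levels) (S T : Subset n) → Dec (Adj A S T)
adj? A S T = A ∣ S ∣ ≟ᵇ true ×-dec A ∣ T ∣ ≟ᵇ true ×-dec
  ((∣ S ∣ ≟ ∣ T ∣ ×-dec suc ∣ S ∩ T ∣ ≟ ∣ S ∣) ⊎-dec consecIncl? A S T ⊎-dec consecIncl? A T S)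

picks : ∀ {X : Set} → List X → List (X × List X)
picks []       = []
picks (x ∷ xs) = (x , xs) ∷ map (λ { (y , ys) → y , x ∷ ys }) (picks xs)

picks-↭ : ∀ {X : Set} (xs : List X) {y ys} → (y , ys) ∈ picks xs → y ∷ ys ↭ xs
picks-↭ (x ∷ xs) (here refl) = ↭-refl
picks-↭ (x ∷ xs) (there i) with ∈-map⁻ _ i
... | (y , ys) , j , refl = ↭-trans (swap y x ↭-refl) (prep x (picks-↭ xs j))

∈-picks : ∀ {X : Set} {xs : List X} {y} → y ∈ xs → ∃ λ ys → (y , ys) ∈ picks xs
∈-picks (here refl) = _ , here refl
∈-picks (there i) with ∈-picks i
... | ys , j = _ , there (∈-map⁺ _ j)

data Trie (X : Set) : ℕ → Set where
  leaf : X → Trie X 0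
  node : ∀ {n} → Trie X n → Trie X n → Trie X (suc n)

find-trie : ∀ {X n} → Trie X n → Vec Bool n → X
find-trie (leaf x)   []          = x
find-trie (node l r) (false ∷ S) = find-trie l S
find-trie (node l r) (true ∷ S)  = find-trie r S

trie : ∀ {X} n → (Vec Bool n → X) → Trie X n
trie zero    f = leaf (f [])
trie (suc n) f = node (trie n (f ∘ (false ∷_))) (trie n (f ∘ (true ∷_)))

find-trie-trie : ∀ {X n} (f : Vec Bool n → X) S → find-trie (trie n f) S ≡ f S
find-trie-trie f []          = refl
find-trie-trie f (false ∷ S) = find-trie-trie (f ∘ (false ∷_)) S
find-trie-trie f (true ∷ S)  = find-trie-trie (f ∘ (true ∷_)) S

-- Adjacency is tabulated so that the search evaluates it once per pair of vertices.
adjacency : ∀ n → Levels → Trie (Trie Bool n) n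
adjacency n A = trie n (λ S → trie n (λ T → ⌊ adj? A S T ⌋))

module Search {n : ℕ} (M : Trie (Trie Bool n) n) where

  adj : Subset n → Subset n → Bool
  adj S T = find-trie (find-trie M S) T

  -- The first argument is the number of vertices still to be visited.
  ham : ℕ → (u : Subset n) → List (Subset n) → (v : Subset n) → Bool
  ham zero    u []      v = adj u v
  ham zero    u (_ ∷ _) v = false
  ham (suc f) u rest    v = any (λ { (w , ws) → adj u w ∧ ham f w ws v }) (picks rest)

  -- `rest` holds the vertices other than the current `u` and the ends `v`, `x`, `y`. The first path
  -- either moves on to a vertex of `rest` or closes at `v`, after which the second path must use up
  -- all that remains.
  paired : ℕ → (u : Subset n) → List (Subset n) → (v x y : Subset n) → Bool
  paired zero    u rest v x y = adj u v ∧ ham (length rest) x rest y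
  paired (suc f) u rest v x y =
    any (λ { (w , ws) → adj u w ∧ paired f w ws v x y }) (picks rest) ∨
    (adj u v ∧ ham (length rest) x rest y)

  allHam : List (Subset n) → Bool
  allHam vs = all (λ { (u , r) → all (λ { (v , r) → ham (length r) u r v }) (picks r) }) (picks vs)

  allPaired : List (Subset n) → Bool
  allPaired vs = all (λ { (u , r) → all (λ { (v , r) → all (λ { (x , r) → all (λ { (y , r) →
    paired (length r) u r v x y }) (picks r) }) (picks r) }) (picks r) }) (picks vs)

module SearchSound {n : ℕ} (A : Levels) where
  open Search (adjacency n A)

  edge : ∀ {S S′} → T (adj S S′) → Adj A S S′
  edge {S} {S′} t = toWitness {a? = adj? A S S′} (subst T (trans
    (cong (λ R → find-trie R S′) (find-trie-trie (λ S → trie n (λ T → ⌊ adj? A S T ⌋)) S))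
    (find-trie-trie (λ T → ⌊ adj? A S T ⌋) S′)) t)

  ham-sound : ∀ f u rest v → T (ham f u rest v) → ∃ λ p → Walk A u v p × p ↭ u ∷ v ∷ rest
  ham-sound zero u [] v t = u ∷ v ∷ [] , step (edge t) (single (proj₁ (proj₂ (edge t)))) , ↭-refl
  ham-sound (suc f) u rest v t with find (any⁻ _ (picks rest) t)
  ... | (w , ws) , i , t′ with Equivalence.to T-∧ t′
  ...   | a , h with ham-sound f w ws v h
  ...     | p , W , c = u ∷ p , step (edge a) W ,
    prep u (↭-trans c (↭-trans (swap w v ↭-refl) (prep v (picks-↭ rest i))))

  paired-sound : ∀ f u rest v x y → T (paired f u rest v x y) →
    ∃ λ p → ∃ λ q → Walk A u v p × Walk A x y q × p ++ q ↭ u ∷ v ∷ x ∷ y ∷ rest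
  paired-end : ∀ u rest v x y → T (adj u v ∧ ham (length rest) x rest y) →
    ∃ λ p → ∃ λ q → Walk A u v p × Walk A x y q × p ++ q ↭ u ∷ v ∷ x ∷ y ∷ rest
  paired-end u rest v x y t with Equivalence.to T-∧ t
  ... | a , h with ham-sound (length rest) x rest y h
  ...   | q , W , c = u ∷ v ∷ [] , q , step (edge a) (single (proj₁ (proj₂ (edge a)))) , W ,
    prep u (prep v c)
  paired-sound zero u rest v x y t = paired-end u rest v x y t
  paired-sound (suc f) u rest v x y t with Equivalence.to T-∨ t
  ... | inj₂ e = paired-end u rest v x y e
  ... | inj₁ e with find (any⁻ _ (picks rest) e)
  ...   | (w , ws) , i , t′ with Equivalence.to T-∧ t′
  ...     | a , h with paired-sound f w ws v x y h
  ...       | p , q , V , W , c = u ∷ p , q , step (edge a) V , W ,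
    prep u (↭-trans c (↭-trans (↭-sym (shift w (v ∷ x ∷ y ∷ []) ws))
      (++⁺ˡ (v ∷ x ∷ y ∷ []) (picks-↭ rest i))))

  ∈-rest : ∀ {vs r : List (Subset n)} {u v} → (u , r) ∈ picks vs → v ∈ vs → u ≢ v → v ∈ r
  ∈-rest {vs} i v∈ u≢v with ∈-resp-↭ (↭-sym (picks-↭ vs i)) v∈
  ... | here refl = ⊥-elim (u≢v refl)
  ... | there j   = j

  all-picks : ∀ {f : Subset n × List (Subset n) → Bool} {vs u r} → T (all f (picks vs)) →
    (u , r) ∈ picks vs → T (f (u , r))
  all-picks {f} {vs} t i = All.lookup (all⁺ f (picks vs) t) i

  allHam-sound : T (allHam (vertices n A)) → HamConnected n A
  allHam-sound t {u} {v} vu vv u≢v with ∈-picks (∈-vertices {A = A} u vu)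
  ... | r , i with ∈-picks (∈-rest i (∈-vertices {A = A} v vv) u≢v)
  ...   | r′ , j with ham-sound (length r′) u r′ v (all-picks (all-picks t i) j)
  ...     | p , W , c = p , W , ↭-trans c (↭-trans (prep u (picks-↭ r j)) (picks-↭ _ i))

  allPaired-sound : T (allPaired (vertices n A)) → PairedCoverable n A
  allPaired-sound t {u} {v} {x} {y} (terminals vu vv vx vy u≢v u≢x u≢y v≢x v≢y x≢y)
    with ∈-picks (∈-vertices {A = A} u vu)
  ... | r₁ , i₁ with ∈-picks (∈-rest i₁ (∈-vertices {A = A} v vv) u≢v)
  ... | r₂ , i₂ with ∈-picks (∈-rest i₂ (∈-rest i₁ (∈-vertices {A = A} x vx) u≢x) v≢x)
  ... | r₃ , i₃ with ∈-picks (∈-rest i₃ (∈-rest i₂ (∈-rest i₁ (∈-vertices {A = A} y vy) u≢y) v≢y) x≢y)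
  ... | r₄ , i₄
    with paired-sound (length r₄) u r₄ v x y (all-picks (all-picks (all-picks (all-picks t i₁) i₂) i₃) i₄)
  ... | p , q , V , W , c = p , q , V , W , ↭-trans c (↭-trans
    (prep u (↭-trans (prep v (↭-trans (prep x (picks-↭ r₃ i₄)) (picks-↭ r₂ i₃))) (picks-↭ r₁ i₂)))
    (picks-↭ _ i₁))

-- Only the levels up to n matter

module _ {n : ℕ} {A B : Levels} (A≈B : ∀ k → k ≤ n → A k ≡ B k) where

  IsVertex-cong : ∀ (S : Subset n) → IsVertex A S → IsVertex B S
  IsVertex-cong S v = trans (sym (A≈B ∣ S ∣ (∣p∣≤n S))) v

  ConsecIncl-cong : ∀ (S T : Subset n) → ConsecIncl A S T → ConsecIncl B S T
  ConsecIncl-cong S T (lt , gap , S⊆T) = lt ,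
    (λ k l r → trans (sym (A≈B k (≤-trans (<⇒≤ r) (∣p∣≤n T)))) (gap k l r)) , S⊆T

  Walk-cong : ∀ {u v : Subset n} {p} → Walk A u v p → Walk B u v p
  Walk-cong (single {u} vu) = single (IsVertex-cong u vu)
  Walk-cong (step {u} {w} (vu , vw , e) W) =
    step (IsVertex-cong u vu , IsVertex-cong w vw , rel e) (Walk-cong W)
    where
    rel : JohnsonAdj u w ⊎ ConsecIncl A u w ⊎ ConsecIncl A w u →
      JohnsonAdj u w ⊎ ConsecIncl B u w ⊎ ConsecIncl B w u
    rel (inj₁ j)        = inj₁ j
    rel (inj₂ (inj₁ i)) = inj₂ (inj₁ (ConsecIncl-cong u w i))
    rel (inj₂ (inj₂ i)) = inj₂ (inj₂ (ConsecIncl-cong w u i))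

vertices-cong : ∀ n {A B : Levels} → (∀ k → k ≤ n → A k ≡ B k) → vertices n A ≡ vertices n B
vertices-cong zero A≈B rewrite A≈B 0 z≤n = refl
vertices-cong (suc n) A≈B = cong₂ (λ P Q → map (false ∷_) P ++ map (true ∷_) Q)
  (vertices-cong n (λ k k≤n → A≈B k (m≤n⇒m≤1+n k≤n))) (vertices-cong n (λ k k≤n → A≈B (suc k) (s≤s k≤n)))

module _ {n : ℕ} {A B : Levels} (A≈B : ∀ k → k ≤ n → A k ≡ B k) where

  HamConnected-cong : HamConnected n A → HamConnected n B
  HamConnected-cong H {u} {v} vu vv u≢v
    with H (IsVertex-cong B≈A u vu) (IsVertex-cong B≈A v vv) u≢v
    where
    B≈A : ∀ k → k ≤ n → B k ≡ A k
    B≈A k k≤n = sym (A≈B k k≤n)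
  ... | p , W , c = p , Walk-cong A≈B W , subst (p ↭_) (vertices-cong n A≈B) c

  PairedCoverable-cong : PairedCoverable n A → PairedCoverable n B
  PairedCoverable-cong P {u} {v} {x} {y} (terminals vu vv vx vy uv ux uy vx′ vy′ xy)
    with P (terminals (IsVertex-cong B≈A u vu) (IsVertex-cong B≈A v vv)
                      (IsVertex-cong B≈A x vx) (IsVertex-cong B≈A y vy) uv ux uy vx′ vy′ xy)
    where
    B≈A : ∀ k → k ≤ n → B k ≡ A k
    B≈A k k≤n = sym (A≈B k k≤n)
  ... | p , q , V , W , c = p , q , Walk-cong A≈B V , Walk-cong A≈B W ,
    subst (p ++ q ↭_) (vertices-cong n A≈B) c

-- The base cases, with level sets as finite tables

table : ∀ {m} → Vec Bool m → Levels
table []       _       = false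
table (b ∷ bs) zero    = b
table (b ∷ bs) (suc k) = table bs k

restrict : ∀ m → Levels → Vec Bool m
restrict zero    A = []
restrict (suc m) A = A 0 ∷ restrict m (A ∘ suc)

table-restrict : ∀ m (A : Levels) k → k < m → table (restrict m A) k ≡ A k
table-restrict (suc m) A zero    _  = refl
table-restrict (suc m) A (suc k) k< = table-restrict m (A ∘ suc) k (s<s⁻¹ k<)

allTables : ∀ m → (Vec Bool m → Bool) → Bool
allTables zero    f = f []
allTables (suc m) f = allTables m (f ∘ (false ∷_)) ∧ allTables m (f ∘ (true ∷_))

allTables-sound : ∀ m f → T (allTables m f) → ∀ bs → T (f bs)
allTables-sound zero f t [] = t
allTables-sound (suc m) f t (false ∷ bs) = allTables-sound m _ (proj₁ (Equivalence.to T-∧ t)) bs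
allTables-sound (suc m) f t (true ∷ bs) = allTables-sound m _
  (proj₂ (Equivalence.to (T-∧ {allTables m (f ∘ (false ∷_))}) t)) bs

ham-ok : ∀ n → Vec Bool (suc n) → Bool
ham-ok n bs = Search.allHam (adjacency n (table bs)) (vertices n (table bs))

paired-ok : ∀ n → Vec Bool (suc n) → Bool
paired-ok n bs = Search.allPaired (adjacency n (table bs)) (vertices n (table bs))

-- Marks the level sets with at most one of the levels 1, 2, 3, for which the halves on 3 points are
-- too poor for `paired-step`.
few : Vec Bool 5 → Bool
few (_ ∷ a ∷ b ∷ c ∷ _ ∷ []) = not ((a ∧ b) ∨ (b ∧ c) ∨ (a ∧ c))

abstract
  ham-3 : ∀ bs → T (ham-ok 3 bs)
  ham-3 = allTables-sound 4 (ham-ok 3) tt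

  paired-3 : ∀ bs → T (paired-ok 3 bs)
  paired-3 = allTables-sound 4 (paired-ok 3) tt

  -- An implication written as a disjunction: it is evaluated on all 32 tables, but the search runs
  -- only where `few` holds.
  paired-4 : ∀ bs → T (not (few bs) ∨ paired-ok 4 bs)
  paired-4 = allTables-sound 5 (λ bs → not (few bs) ∨ paired-ok 4 bs) tt

module _ {A : Levels} (H : ∀ b → HamConnected 3 (half b A)) (P : ∀ b → PairedCoverable 3 (half b A)) where
  open Window {3} {0} {A} H P

  -- The window is all of the 3 points and nothing is appended. Exchanges within either level and
  -- inclusions from `k` to `l` all serve as links.
  crossing-two-levels : ∀ {k l L L′ z z′} → Robust (TwoLevels k l) L L′ → z ∈ L → z′ ∈ L′ →
    A k ≡ true → A l ≡ true → (∀ j → k < j → j < l → A j ≡ false) → Crossing {3} A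
  crossing-two-levels {k} {l} all z∈ z′∈ vk vl gap = crossing-window all z∈ z′∈ [] [] cross
    where
    size : ∀ (s : Subset 3) {i} → ∣ s ∣ ≡ i → ∣ s ++ᵛ [] ∣ ≡ i
    size s e = trans (∣++∣ s []) (trans (+-identityʳ ∣ s ∣) e)
    cross : ∀ s s′ → TwoLevels k l s s′ → Cross A (s ++ᵛ []) (s′ ++ᵛ [])
    cross s s′ (inj₁ (s′⊆s , e , on)) = same (++-⊆ s′ s s′⊆s ⊆-refl)
      (trans (size s e) (cong suc (sym (size s′ refl)))) (trans (cong A (size s refl)) (in-level on))
      where
      in-level : ∣ s ∣ ≡ k ⊎ ∣ s ∣ ≡ l → A ∣ s ∣ ≡ true
      in-level (inj₁ e) = trans (cong A e) vk
      in-level (inj₂ e) = trans (cong A e) vl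
    cross s s′ (inj₂ (s⊆s′ , e , e′)) = up (++-⊆ s s′ s⊆s′ ⊆-refl)
      (trans (cong A (size s e)) vk) (trans (cong A 1+size) vl)
      λ j lo hi → gap j (subst (_< j) (size s e) lo) (subst (j <_) 1+size hi)
      where
      1+size : suc ∣ s′ ++ᵛ [] ∣ ≡ l
      1+size = trans (cong suc (size s′ refl)) e′

InnerSize : Bool → ℕ → Set
InnerSize false k = k ≢ 0
InnerSize true  k = k ≢ 3

innerSize : ∀ b (S : Subset 3) {k} → InnerSize b k → ∣ S ∣ ≡ k → Inner b S
innerSize false S inner refl = inner
innerSize true  S inner refl = inner

-- Two levels of `Inner` sets with four or more members together leave one besides the three given
-- vertices.
fourth-two-levels : ∀ {A : Levels} → (∀ b → ∃ λ k → ∃ λ l → half b A k ≡ true × half b A l ≡ true ×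
  InnerSize b k × InnerSize b l × 4 ≤ length (level₂ 3 k l)) → FourthVertex {3} A
fourth-two-levels {A} levels b {u} {v} {x} _ _ _ _ _ _ with levels b
... | k , l , vk , vl , ik , il , 4≤
  with pigeonhole {F = u ∷ v ∷ x ∷ []} (vertices-unique 3 (λ j → (j ≡ᵇ k) ∨ (j ≡ᵇ l))) 4≤
... | s , s∈ , s∉ = s , proj₁ ok , proj₂ ok ,
  (λ { refl → s∉ (here refl) }) , (λ { refl → s∉ (there (here refl)) }) ,
  (λ { refl → s∉ (there (there (here refl))) })
  where
  ok : IsVertex (half b A) s × Inner b s
  ok with Equivalence.to T-∨ (Equivalence.from T-≡ (vertices-sound 3 {λ j → (j ≡ᵇ k) ∨ (j ≡ᵇ l)} s∈))
  ... | inj₁ e = trans (cong (half b A) (≡ᵇ⇒≡ ∣ s ∣ k e)) vk , innerSize b s ik (≡ᵇ⇒≡ ∣ s ∣ k e)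
  ... | inj₂ e = trans (cong (half b A) (≡ᵇ⇒≡ ∣ s ∣ l e)) vl , innerSize b s il (≡ᵇ⇒≡ ∣ s ∣ l e)

ham-base : ∀ A → HamConnected 3 A
ham-base A = HamConnected-cong (λ k k≤ → table-restrict 4 A k (s≤s k≤))
  (SearchSound.allHam-sound (table (restrict 4 A)) (ham-3 (restrict 4 A)))

paired-base : ∀ A → PairedCoverable 3 A
paired-base A = PairedCoverable-cong (λ k k≤ → table-restrict 4 A k (s≤s k≤))
  (SearchSound.allPaired-sound (table (restrict 4 A)) (paired-3 (restrict 4 A)))

ham-base-4 : ∀ A → HamConnected 4 A
ham-base-4 A = ham-step (s≤s (s≤s z≤n)) (λ b → ham-base (half b A))

-- If two of the levels 1, 2, 3 are occupied, each half has two suitable levels and `paired-step`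
-- applies; otherwise the search decides.
paired-base-4 : ∀ A → PairedCoverable 4 A
paired-base-4 A = split (A 1) (A 2) (A 3) refl refl refl
  where
  H : ∀ b → HamConnected 3 (half b A)
  H b = ham-base (half b A)
  P : ∀ b → PairedCoverable 3 (half b A)
  P b = paired-base (half b A)
  adjacent : ∀ k j → k < j → j < suc k → A j ≡ false
  adjacent k j l r = ⊥-elim (<⇒≱ r l)
  few-split : ∀ {p q r} → A 1 ≡ p → A 2 ≡ q → A 3 ≡ r →
    few (restrict 5 A) ≡ not ((p ∧ q) ∨ (q ∧ r) ∨ (p ∧ r))
  few-split refl refl refl = refl
  search-4 : few (restrict 5 A) ≡ true → PairedCoverable 4 A
  search-4 e = PairedCoverable-cong (λ k k≤ → table-restrict 5 A k (s≤s k≤))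
    (SearchSound.allPaired-sound (table (restrict 5 A))
      (subst (λ c → T (not c ∨ paired-ok 4 (restrict 5 A))) e (paired-4 (restrict 5 A))))
  split : ∀ p q r → A 1 ≡ p → A 2 ≡ q → A 3 ≡ r → PairedCoverable 4 A
  split true true r e f g = paired-step H P
    (fourth-two-levels λ { false → 1 , 2 , e , f , (λ ()) , (λ ()) , s≤s (s≤s (s≤s (s≤s z≤n)))
                         ; true → 0 , 1 , e , f , (λ ()) , (λ ()) , s≤s (s≤s (s≤s (s≤s z≤n))) })
    (crossing-two-levels H P twoLevels-1-2 (here refl) (here refl) e f (adjacent 1))
  split false true true e f g = paired-step H P
    (fourth-two-levels λ { false → 2 , 3 , f , g , (λ ()) , (λ ()) , s≤s (s≤s (s≤s (s≤s z≤n)))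
                         ; true → 1 , 2 , f , g , (λ ()) , (λ ()) , s≤s (s≤s (s≤s (s≤s z≤n))) })
    (crossing-two-levels H P twoLevels-2-3 (here refl) (here refl) f g (adjacent 2))
  split true false true e f g = paired-step H P
    (fourth-two-levels λ { false → 1 , 3 , e , g , (λ ()) , (λ ()) , s≤s (s≤s (s≤s (s≤s z≤n)))
                         ; true → 0 , 2 , e , g , (λ ()) , (λ ()) , s≤s (s≤s (s≤s (s≤s z≤n))) })
    (crossing-two-levels H P twoLevels-1-3 (here refl) (here refl) e g
      λ { (suc (suc zero)) _ _ → f ; (suc zero) (s≤s ()) _ ; (suc (suc (suc _))) _ (s≤s (s≤s (s≤s ()))) })
  split true false false e f g = search-4 (few-split e f g)
  split false true false e f g = search-4 (few-split e f g)
  split false false true e f g = search-4 (few-split e f g)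
  split false false false e f g = search-4 (few-split e f g)

-- The induction and the theorem

coverable-step : ∀ r → (∀ A → HamConnected (4 + r) A × PairedCoverable (4 + r) A) →
  ∀ A → HamConnected (5 + r) A × PairedCoverable (5 + r) A
coverable-step r ih A =
  ham-step (s≤s (s≤s z≤n)) H ,
  paired-step H P (fourth-vertex (s≤s (s≤s (s≤s (s≤s z≤n))))) (crossing-step H P)
  where
  H : ∀ b → HamConnected (4 + r) (half b A)
  H b = proj₁ (ih (half b A))
  P : ∀ b → PairedCoverable (4 + r) (half b A)
  P b = proj₂ (ih (half b A))

-- `coverable-step` needs halves on at least 4 points, hence the two starting cases. `A` stays
-- universally quantified because the second half has the shifted level set.
coverable : ∀ r A → HamConnected (3 + r) A × PairedCoverable (3 + r) A
coverable zero          A = ham-base A , paired-base A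
coverable (suc zero)    A = ham-base-4 A , paired-base-4 A
coverable (suc (suc r)) A = coverable-step r (coverable (suc r)) A

++-unique : ∀ {a} {X : Set a} (xs : List X) {ys} → Unique (xs ++ ys) →
  Unique xs × Unique ys × (∀ z → z ∈ xs → z ∉ ys)
++-unique []       u        = [] , u , λ _ ()
++-unique (x ∷ xs) (x∉ ∷ u) with ++-unique xs u
... | uxs , uys , disjoint = ++⁻ˡ xs x∉ ∷ uxs , uys , λ
  { z (here refl) z∈ → All.lookup (++⁻ʳ xs x∉) z∈ refl
  ; z (there i)   z∈ → disjoint z i z∈ }

Unique-resp-↭ : ∀ {a} {X : Set a} {xs ys : List X} → xs ↭ ys → Unique xs → Unique ys
Unique-resp-↭ {X = X} p = ↭ₛ.Unique-resp-↭ (setoid X) (↭⇒↭ₛ p)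

theorem9 : (n : ℕ) → 4 ≤ n → (A : ℕ → Bool) →
    (∀ k → A k ≡ true → 1 ≤ k × k ≤ n) →
    (∃ λ k → A k ≡ true) →
    AtLeastFourVertices {n} A →
    PairedTwoCoverable {n} A
-- Matching three layers of the bound writes `n` as `3 + r`, the form in which `coverable` is
-- stated.
theorem9 n (s≤s (s≤s (s≤s {n = r} _))) A _ _ _ u v x y vu vv vx vy uv ux uy vx′ vy′ xy
  with proj₂ (coverable r A) (terminals vu vv vx vy uv ux uy vx′ vy′ xy)
-- `p ++ q` is a permutation of a list without repetitions, so both paths are simple and they are
-- disjoint; the same permutation shows that every vertex is covered.
... | p , q , P , Q , c with ++-unique p (Unique-resp-↭ (↭-sym c) (vertices-unique n A))
...   | uniqueₚ , unique_q , disjoint = p , q , (P , uniqueₚ) , (Q , unique_q) , disjoint ,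
  λ S vS → ∈-++⁻ p (∈-resp-↭ (↭-sym c) (∈-vertices S vS))
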